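{- Let $G_1, G_2$ be arbitrary simple graphs on $n_1, n_2 \geq 1$ vertices, respectively, and let $\lambda_1(G_1) \geq \dots \geq \lambda_{n_1}(G_1)$ be the eigenvalues of the adjacency matrix $A(G_1)$. Then $$\phi(A(G_1 \star G_2); x) = (\phi(A(G_2); x))^{n_1} \cdot \prod_{i=1}^{n_1} \left(x - \lambda_i(G_1) - \Gamma_{A(G_2)}(x)\,\lambda_i(G_1)^2\right).$$
   Context: All graphs are finite, undirected and simple. For a square matrix $M$ of order $n$, $\phi(M;x)=\det(xI_n-M)$ is its characteristic polynomial, and its $M$-coronal is the rational function $\Gamma_M(x)=\mathbf{1}_n^T(xI_n-M)^{ -1}\mathbf{1}_n$, where $\mathbf{1}_n$ is the all-ones column vector of length $n$. $A(G)$ denotes the adjacency matrix of a graph $G$. The neighbourhood corona $G_1\star G_2$ of graphs $G_1$ (with vertices $v_1,\dots,v_{n_1}$) and $G_2$ (on $n_2$ vertices) is the graph obtained by taking one copy of $G_1$ and $n_1$ copies of $G_2$, all vertex-disjoint, and joining every neighbour (in $G_1$) of the $i$th vertex $v_i$ of $G_1$ to every vertex of the $i$th copy of $G_2$ by a new edge, for each $i=1,\dots,n_1$. The identity is an identity of rational functions in $x$. -}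

module Defs where

open import Level using (Level; _⊔_)
open import Data.Nat using (ℕ)
import Data.Nat as ℕ
open import Data.Fin using (Fin; zero; suc; splitAt; remQuot; punchIn; _≟_)
open import Data.Bool using (Bool; true; false; if_then_else_; _∧_)
open import Data.Sum using (_⊎_; inj₁; inj₂)
open import Data.Product using (_×_; _,_; Σ; ∃)
open import Data.List using (List; []; _∷_)
open import Data.Unit.Polymorphic using (⊤)
open import Relation.Nullary using (¬_; does; yes; no)
open import Data.Empty using (⊥-elim)
open import Relation.Binary.PropositionalEquality using (_≡_; refl; cong₂; trans)
open import Data.Bool.Properties using (∧-zeroʳ)
open import Algebra.Bundles using (CommutativeRing)

record Graph (n : ℕ) : Set where
  field
    adj    : Fin n → Fin n → Bool
    sym    : ∀ i j → adj i j ≡ adj j i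
    irrefl : ∀ i → adj i i ≡ false
open Graph public

-- Vertex set of G₁ ⋆ G₂ is Fin (n₁ ℕ.+ n₁ ℕ.* n₂): the first n₁ vertices are the
-- copy of G₁, the vertex  n₁ + combine k u  is vertex u of the k-th copy of G₂.
data CoronaVertex (n₁ n₂ : ℕ) : Set where
  base : Fin n₁ → CoronaVertex n₁ n₂
  copy : Fin n₁ → Fin n₂ → CoronaVertex n₁ n₂

classify : ∀ {n₁ n₂} → Fin (n₁ ℕ.+ n₁ ℕ.* n₂) → CoronaVertex n₁ n₂
classify {n₁} {n₂} v with splitAt n₁ v
... | inj₁ i = base i
... | inj₂ w with remQuot {n₁} n₂ w
...   | (k , u) = copy k u

coronaAdjV : ∀ {n₁ n₂} → Graph n₁ → Graph n₂ →
             CoronaVertex n₁ n₂ → CoronaVertex n₁ n₂ → Bool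
coronaAdjV G₁ G₂ (base i)   (base j)    = adj G₁ i j
coronaAdjV G₁ G₂ (base i)   (copy k u)  = adj G₁ k i
coronaAdjV G₁ G₂ (copy k u) (base i)    = adj G₁ k i
coronaAdjV G₁ G₂ (copy k u) (copy l w)  = does (k ≟ l) ∧ adj G₂ u w

coronaAdjV-sym : ∀ {n₁ n₂} (G₁ : Graph n₁) (G₂ : Graph n₂) v w →
                 coronaAdjV G₁ G₂ v w ≡ coronaAdjV G₁ G₂ w v
coronaAdjV-sym G₁ G₂ (base i)   (base j)   = sym G₁ i j
coronaAdjV-sym G₁ G₂ (base i)   (copy k u) = refl
coronaAdjV-sym G₁ G₂ (copy k u) (base i)   = refl
coronaAdjV-sym G₁ G₂ (copy k u) (copy l w) with k ≟ l | l ≟ k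
... | yes refl | yes _  = cong₂ _∧_ refl (sym G₂ u w)
... | yes refl | no k≢k = ⊥-elim (k≢k refl)
... | no k≢l   | yes refl = ⊥-elim (k≢l refl)
... | no _     | no _   = refl

coronaAdjV-irrefl : ∀ {n₁ n₂} (G₁ : Graph n₁) (G₂ : Graph n₂) v →
                    coronaAdjV G₁ G₂ v v ≡ false
coronaAdjV-irrefl G₁ G₂ (base i)   = irrefl G₁ i
coronaAdjV-irrefl G₁ G₂ (copy k u) =
  trans (cong₂ _∧_ refl (irrefl G₂ u)) (∧-zeroʳ (does (k ≟ k)))

infixl 7 _⋆_
_⋆_ : ∀ {n₁ n₂} → Graph n₁ → Graph n₂ → Graph (n₁ ℕ.+ n₁ ℕ.* n₂)
adj    (G₁ ⋆ G₂) v w = coronaAdjV G₁ G₂ (classify v) (classify w)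
sym    (G₁ ⋆ G₂) v w = coronaAdjV-sym G₁ G₂ (classify v) (classify w)
irrefl (G₁ ⋆ G₂) v   = coronaAdjV-irrefl G₁ G₂ (classify v)

module Over {c ℓ : Level} (R : CommutativeRing c ℓ) where
  open CommutativeRing R using (_≈_; _+_; _*_; -_; 0#; 1#) renaming (Carrier to K)

  IsField : Set (c ⊔ ℓ)
  IsField = (¬ (1# ≈ 0#)) × (∀ a → ¬ (a ≈ 0#) → Σ K λ b → a * b ≈ 1#)

  Matrix : ℕ → Set c
  Matrix n = Fin n → Fin n → K

  A : ∀ {n} → Graph n → Matrix n
  A G i j = if adj G i j then 1# else 0#

  -- Polynomials in x over K: coefficient lists, lowest degree first
  Poly : Set c
  Poly = List K

  infix 4 _≈P_
  _≈P_ : Poly → Poly → Set ℓ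
  []      ≈P []      = ⊤
  []      ≈P (b ∷ q) = (0# ≈ b) × ([] ≈P q)
  (a ∷ p) ≈P []      = (a ≈ 0#) × (p ≈P [])
  (a ∷ p) ≈P (b ∷ q) = (a ≈ b) × (p ≈P q)

  0P 1P X : Poly
  0P = []
  1P = 1# ∷ []
  X  = 0# ∷ 1# ∷ []

  constP : K → Poly
  constP a = a ∷ []

  infixl 6 _+P_ _-P_
  infixl 7 _*P_ _·P_
  _+P_ : Poly → Poly → Poly
  []      +P q       = q
  (a ∷ p) +P []      = a ∷ p
  (a ∷ p) +P (b ∷ q) = (a + b) ∷ (p +P q)

  _·P_ : K → Poly → Poly
  a ·P []      = []
  a ·P (b ∷ q) = (a * b) ∷ (a ·P q)

  -P_ : Poly → Poly
  -P p = (- 1#) ·P p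

  _-P_ : Poly → Poly → Poly
  p -P q = p +P (-P q)

  _*P_ : Poly → Poly → Poly
  []      *P q = []
  (a ∷ p) *P q = (a ·P q) +P (0# ∷ (p *P q))

  ∏P : ∀ {n} → (Fin n → Poly) → Poly
  ∏P {ℕ.zero}  f = 1P
  ∏P {ℕ.suc n} f = f zero *P ∏P (λ i → f (suc i))

  altSumP : ∀ {k} → (Fin k → Poly) → Poly
  altSumP {ℕ.zero}  t = 0P
  altSumP {ℕ.suc k} t = t zero -P altSumP (λ j → t (suc j))

  detP : ∀ {n} → (Fin n → Fin n → Poly) → Poly
  detP {ℕ.zero}  M = 1P
  detP {ℕ.suc n} M =
    altSumP (λ j → M zero j *P detP (λ r s → M (suc r) (punchIn j s)))

  xI-P : ∀ {n} → Matrix n → Fin n → Fin n → Poly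
  xI-P M i j = (if does (i ≟ j) then X else 0P) -P constP (M i j)

  φ : ∀ {n} → Matrix n → Poly
  φ M = detP (xI-P M)

  record RatFun : Set c where
    constructor _/_
    field
      num : Poly
      den : Poly
  open RatFun public

  infix 4 _≈R_
  _≈R_ : RatFun → RatFun → Set ℓ
  (p / q) ≈R (r / s) = p *P s ≈P r *P q

  NonZeroP : Poly → Set ℓ
  NonZeroP p = ¬ (p ≈P 0P)

  poly : Poly → RatFun
  poly p = p / 1P

  infixl 6 _+R_ _-R_
  infixl 7 _*R_
  _+R_ : RatFun → RatFun → RatFun
  (p / q) +R (r / s) = ((p *P s) +P (r *P q)) / (q *P s)

  _*R_ : RatFun → RatFun → RatFun
  (p / q) *R (r / s) = (p *P r) / (q *P s)

  -R_ : RatFun → RatFun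
  -R (p / q) = (-P p) / q

  _-R_ : RatFun → RatFun → RatFun
  a -R b = a +R (-R b)

  0R 1R : RatFun
  0R = poly 0P
  1R = poly 1P

  ΣR : ∀ {n} → (Fin n → RatFun) → RatFun
  ΣR {ℕ.zero}  f = 0R
  ΣR {ℕ.suc n} f = f zero +R ΣR (λ i → f (suc i))

  ∏R : ∀ {n} → (Fin n → RatFun) → RatFun
  ∏R {ℕ.zero}  f = 1R
  ∏R {ℕ.suc n} f = f zero *R ∏R (λ i → f (suc i))

  _^R_ : RatFun → ℕ → RatFun
  a ^R ℕ.zero  = 1R
  a ^R ℕ.suc k = a *R (a ^R k)

  IsInverseOf-xI- : ∀ {n} → Matrix n → (Fin n → Fin n → RatFun) → Set ℓ
  IsInverseOf-xI- {n} M B =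
    (∀ i j → NonZeroP (den (B i j))) ×
    (∀ i j → ΣR (λ k → poly (xI-P M i k) *R B k j)
               ≈R (if does (i ≟ j) then 1R else 0R))

  -- M-coronal  Γ_M(x) = 1ᵀ (x I - M)⁻¹ 1, given the inverse B
  coronal : ∀ {n} → (Fin n → Fin n → RatFun) → RatFun
  coronal B = ΣR (λ i → ΣR (λ j → B i j))

{-# OPTIONS --safe #-}
-- Let N = xI - A(G₂) and let E be the product of all denominators of N⁻¹, so
-- that N B = E with polynomial entries in B and Γ = C / E for C the sum of the
-- entries of B. Multiplying the characteristic matrix of G₁ ⋆ G₂ on the right by
-- a block lower triangular matrix of determinant E^n₁ makes it block upper
-- triangular with diagonal blocks E(x - A) - C A², for A = A(G₁), and I ⊗ N; no
-- division is needed. It remains to see that det (w + vA + uA²) = ∏ (w + vλ + uλ²)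
-- over every commutative ring T containing the base field. Replacing u by an
-- indeterminate we may assume that u is regular. Over a quadratic extension of T
-- containing roots α, β of y² + vy + uw one has u(w + vA + uA²) = (uA - α)(uA - β),
-- so the claim reduces to det (α - uA) = ∏ (α - uλ), which is a homogenised form
-- of the hypothesis det (x - A) = ∏ (x - λ).
module Submission where

-- The eigenvalue hypothesis is only an identity of polynomials. Equality in the field need not be
-- decidable, so elimination cannot search for pivots, and no eigenvectors or triangular form of `A`
-- are at hand: det (w + vA + uA²) has to be reached from det (x - A) by changes of ring alone.
-- Regularity of u is the price. Factoring introduces a surplus power of u that must be cancelled,
-- and substituting u y for y is injective only if u kills no coefficient. In the application u is
-- `- C`, about which nothing of the kind is known. An indeterminate is always regular, and stays so
-- in a quadratic extension because elements of the base act on each coordinate separately. The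
-- shape of E comes from the definitions: a `RatFun` is an unreduced pair, so the denominator of
-- `coronal B` is the product of all denominators of `B`. Each of the n₁ factors on the right
-- carries it, which gives exactly the power `E ^ n₁` produced by the block triangular multiplier.
-- Since `detP` is the expansion along the first row, multiplicativity is derived from the
-- uniqueness of alternating forms.

open import Defs using (Graph; module Graph; adj; _⋆_; module Over)
open import Level using (Level; _⊔_)
open import Algebra.Bundles using (CommutativeRing; RawRing)
open import Algebra.Morphism.Construct.Composition using () renaming (isRingHomomorphism to ∘-isRingHomomorphism)
open import Algebra.Morphism.Construct.Identity using () renaming (isRingHomomorphism to id-isRingHomomorphism)
open import Algebra.Morphism.Structures using (IsRingHomomorphism)
open import Data.Bool using (Bool; true; false; if_then_else_)
open import Data.Empty using (⊥-elim)
open import Data.Fin as Fin using (Fin; zero; suc; punchIn; inject₁; splitAt; _↑ˡ_; _↑ʳ_; remQuot)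
open import Data.Fin.Induction using (<-weakInduction)
open import Data.Fin.Properties using (splitAt-↑ˡ; splitAt-↑ʳ)
open import Data.Maybe using (Maybe; just; nothing)
open import Data.Nat as ℕ using (ℕ; zero; suc; _≤_)
open import Data.Product using (_×_; _,_; proj₁; proj₂)
open import Data.Sum as Sum using (_⊎_; inj₁; inj₂)
open import Data.Unit.Polymorphic using (⊤; tt)
open import Data.Vec.Functional using (Vector; head; tail; insertAt; updateAt)
open import Function using (_∘_; const)
open import Relation.Binary.PropositionalEquality as ≡ using (_≡_)
open import Relation.Nullary using (¬_; does; yes; no)


-- The library's ring solver with integer coefficients, a pair (a , b) standing
-- for a - b: only a coefficient ring with decidable equality cancels x - x.
module RingSolver {c ℓ} (R : CommutativeRing c ℓ) where
  open CommutativeRing R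
  open import Algebra.Properties.Ring ring
  open import Algebra.Properties.Semiring.Mult.TCOptimised semiring
    using (×-homo-+; ×1-homo-*) renaming (_×_ to _⊠_)
  open import Algebra.Solver.Ring.AlmostCommutativeRing
    using (fromCommutativeRing; _-Raw-AlmostCommutative⟶_; Induced-equivalence)
  open import Algebra.Solver.Ring.NaturalCoefficients.Default commutativeSemiring as N
    using () renaming (_:=_ to _⟨=⟩_; _:+_ to _⟨+⟩_; _:*_ to _⟨*⟩_)
  open import Relation.Binary.Reasoning.Setoid setoid

  private
    Coefficients : RawRing _ _
    Coefficients = record
      { Carrier = ℕ × ℕ
      ; _≈_     = _≡_
      ; _+_     = λ (a , b) (a′ , b′) → a ℕ.+ a′ , b ℕ.+ b′
      ; _*_     = λ (a , b) (a′ , b′) → a ℕ.* a′ ℕ.+ b ℕ.* b′ , a ℕ.* b′ ℕ.+ b ℕ.* a′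
      ; -_      = λ (a , b) → b , a
      ; 0#      = 0 , 0
      ; 1#      = 1 , 0
      }

    open RawRing Coefficients using () renaming (_+_ to _⊕_; _*_ to _⊗_)

    embed : ℕ → Carrier
    embed n = n ⊠ 1#

    difference value : ℕ × ℕ → Carrier
    difference (a , b) = embed a - embed b

    -- The case b = 0 is separate so that (0 , 0) and (1 , 0) denote 0# and 1# definitionally.
    value (a , zero)  = embed a
    value (a , suc b) = difference (a , suc b)

    value≈ : ∀ p → value p ≈ difference p
    value≈ (a , zero)  = sym (trans (+-congˡ -0#≈0#) (+-identityʳ _))
    value≈ (a , suc b) = refl

    +-lemma : ∀ a b a′ b′ → (a + a′) - (b + b′) ≈ (a - b) + (a′ - b′)
    +-lemma a b a′ b′ = begin
      (a + a′) - (b + b′)       ≈⟨ +-congˡ (-‿+-comm b b′) ⟨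
      (a + a′) + (- b + - b′)   ≈⟨ N.solve 4 (λ a a′ b b′ → (a ⟨+⟩ a′) ⟨+⟩ (b ⟨+⟩ b′) ⟨=⟩ (a ⟨+⟩ b) ⟨+⟩ (a′ ⟨+⟩ b′)) refl a a′ (- b) (- b′) ⟩
      (a - b) + (a′ - b′)       ∎

    *-lemma : ∀ a b a′ b′ → (a * a′ + b * b′) - (a * b′ + b * a′) ≈ (a - b) * (a′ - b′)
    *-lemma a b a′ b′ = begin
      (a * a′ + b * b′) - (a * b′ + b * a′)
        ≈⟨ +-cong (+-congˡ (sym (-‿involutive _))) (sym (-‿+-comm _ _)) ⟩
      (a * a′ + - - (b * b′)) + (- (a * b′) + - (b * a′))
        ≈⟨ +-cong (+-congˡ (trans (-‿cong (-‿distribˡ-* b b′)) (-‿distribʳ-* (- b) b′))) (+-cong (-‿distribʳ-* a b′) (-‿distribˡ-* b a′)) ⟩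
      (a * a′ + - b * - b′) + (a * - b′ + - b * a′)
        ≈⟨ N.solve 4 (λ a a′ b b′ → (a ⟨*⟩ a′ ⟨+⟩ b ⟨*⟩ b′) ⟨+⟩ (a ⟨*⟩ b′ ⟨+⟩ b ⟨*⟩ a′) ⟨=⟩ (a ⟨+⟩ b) ⟨*⟩ (a′ ⟨+⟩ b′)) refl a a′ (- b) (- b′) ⟩
      (a - b) * (a′ - b′) ∎

    +-homo : ∀ p q → difference (p ⊕ q) ≈ difference p + difference q
    +-homo (a , b) (a′ , b′) = trans
      (+-cong (×-homo-+ 1# a a′) (-‿cong (×-homo-+ 1# b b′)))
      (+-lemma (embed a) (embed b) (embed a′) (embed b′))

    *-homo : ∀ p q → difference (p ⊗ q) ≈ difference p * difference q
    *-homo (a , b) (a′ , b′) = trans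
      (+-cong (trans (×-homo-+ 1# (a ℕ.* a′) (b ℕ.* b′)) (+-cong (×1-homo-* a a′) (×1-homo-* b b′)))
        (-‿cong (trans (×-homo-+ 1# (a ℕ.* b′) (b ℕ.* a′)) (+-cong (×1-homo-* a b′) (×1-homo-* b a′)))))
      (*-lemma (embed a) (embed b) (embed a′) (embed b′))

    morphism : Coefficients -Raw-AlmostCommutative⟶ fromCommutativeRing R
    morphism = record
      { ⟦_⟧    = value
      ; +-homo = λ p q → trans (value≈ (p ⊕ q)) (trans (+-homo p q) (sym (+-cong (value≈ p) (value≈ q))))
      ; *-homo = λ p q → trans (value≈ (p ⊗ q)) (trans (*-homo p q) (sym (*-cong (value≈ p) (value≈ q))))
      ; -‿homo = λ p → trans (value≈ (RawRing.-_ Coefficients p)) (trans (sym (⁻¹-anti-homo‿- _ _)) (-‿cong (sym (value≈ p))))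
      ; 0-homo = refl
      ; 1-homo = refl
      }

    cross : ∀ a b a′ b′ → a + b′ ≈ a′ + b → a - b ≈ a′ - b′
    cross a b a′ b′ eq = begin
      a - b                    ≈⟨ +-identityʳ _ ⟨
      a - b + 0#               ≈⟨ +-congˡ (-‿inverseʳ b′) ⟨
      a - b + (b′ - b′)        ≈⟨ N.solve 4 (λ a b c d → (a ⟨+⟩ b) ⟨+⟩ (c ⟨+⟩ d) ⟨=⟩ (a ⟨+⟩ c) ⟨+⟩ (b ⟨+⟩ d)) refl a (- b) b′ (- b′) ⟩
      a + b′ + (- b - b′)      ≈⟨ +-congʳ eq ⟩
      a′ + b + (- b - b′)      ≈⟨ N.solve 4 (λ a b c d → (a ⟨+⟩ b) ⟨+⟩ (c ⟨+⟩ d) ⟨=⟩ (a ⟨+⟩ d) ⟨+⟩ (b ⟨+⟩ c)) refl a′ b (- b) (- b′) ⟩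
      a′ - b′ + (b - b)        ≈⟨ +-congˡ (-‿inverseʳ b) ⟩
      a′ - b′ + 0#             ≈⟨ +-identityʳ _ ⟩
      a′ - b′                  ∎

    -- Equality of integers, tested on pairs as a + b′ = a′ + b in ℕ; `cross` carries it over to the
    -- differences. The answer `nothing` claims no inequality: distinct integers may agree in `R`.
    decide : ∀ p q → Maybe (value p ≈ value q)
    decide (a , b) (a′ , b′) with a ℕ.+ b′ ℕ.≟ a′ ℕ.+ b
    ... | yes eq = just (trans (value≈ (a , b)) (trans (cross _ _ _ _ (trans (sym (×-homo-+ 1# a b′))
                     (trans (reflexive (≡.cong embed eq)) (×-homo-+ 1# a′ b)))) (sym (value≈ (a′ , b′)))))
    ... | no _ = nothing

  open import Algebra.Solver.Ring Coefficients (fromCommutativeRing R) morphism decide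
    public using (solve; _:=_; _:+_; _:*_; _:-_; :-_; con; Polynomial)

  :0 :1 : ∀ {n} → Polynomial n
  :0 = con (0 , 0)
  :1 = con (1 , 0)

-- Determinants: the expansion along the first row is alternating in the rows.

module Determinant {c ℓ} (R : CommutativeRing c ℓ) where
  open CommutativeRing R hiding (zero)
  open import Data.Vec.Functional using (_∷_)
  open RingSolver R
  open import Algebra.Properties.Ring ring using (-1*x≈-x)
  open import Algebra.Properties.Semiring.Sum semiring public
    using (sum; sum-cong-≋; ∑-distrib-+; *-distribˡ-sum; *-distribʳ-sum; ∑-comm; sum-replicate-zero)
  open import Relation.Binary.Reasoning.Setoid setoid

  private
    Row : ℕ → Set c
    Row = Vector Carrier

    variable
      m n k : ℕ

  infix 4 _≋_
  _≋_ : (u v : Row n) → Set ℓ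
  u ≋ v = ∀ i → u i ≈ v i

  -- As a matrix `δ` is the identity; as a row `δ i` is the i-th standard basis vector.
  δ : Fin n → Row n
  δ i j = if does (i Fin.≟ j) then 1# else 0#

  -- Opaque, so that the length of t can be inferred from altSum t.
  opaque
    altSum : Row n → Carrier
    altSum {zero}  t = 0#
    altSum {suc n} t = t zero - altSum (λ j → t (suc j))

    altSum-suc : (t : Row (suc n)) → altSum t ≈ t zero - altSum (λ j → t (suc j))
    altSum-suc t = refl

    altSum-cong : {t u : Row n} → t ≋ u → altSum t ≈ altSum u
    altSum-cong {zero}  t≋u = refl
    altSum-cong {suc n} t≋u = +-cong (t≋u zero) (-‿cong (altSum-cong {n} (λ j → t≋u (suc j))))

    altSum-linear : ∀ a (t u : Row n) → altSum (λ j → a * t j + u j) ≈ a * altSum t + altSum u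
    altSum-linear {zero}  a t u = solve 1 (λ a → :0 := a :* :0 :+ :0) refl a
    altSum-linear {suc n} a t u = begin
      a * t zero + u zero - altSum {n} (λ j → a * t (suc j) + u (suc j))
        ≈⟨ +-congˡ (-‿cong (altSum-linear {n} a _ _)) ⟩
      a * t zero + u zero - (a * altSum (tail t) + altSum (tail u))
        ≈⟨ solve 5 (λ a t u x y → a :* t :+ u :- (a :* x :+ y) := a :* (t :- x) :+ (u :- y)) refl a _ _ _ _ ⟩
      a * (t zero - altSum (tail t)) + (u zero - altSum (tail u)) ∎

    altSum-zero : {t : Row n} → (∀ j → t j ≈ 0#) → altSum t ≈ 0#
    altSum-zero {zero}  t≈0 = refl
    altSum-zero {suc n} t≈0 = trans (+-cong (t≈0 zero) (-‿cong (altSum-zero {n} (λ j → t≈0 (suc j))))) (-‿inverseʳ 0#)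

  altSum-+ : (t u : Row n) → altSum (λ j → t j + u j) ≈ altSum t + altSum u
  altSum-+ t u = trans (altSum-cong (λ j → +-congʳ (sym (*-identityˡ _))))
    (trans (altSum-linear 1# t u) (+-congʳ (*-identityˡ _)))

  altSum-scale : ∀ a (t : Row n) → altSum (λ j → a * t j) ≈ a * altSum t
  altSum-scale a t = trans (altSum-cong (λ j → sym (+-identityʳ _)))
    (trans (altSum-linear a t (λ _ → 0#)) (trans (+-congˡ (altSum-zero {t = λ _ → 0#} (λ _ → refl))) (+-identityʳ _)))

  altSum-neg : (t : Row n) → altSum (λ j → - t j) ≈ - altSum t
  altSum-neg t = trans (altSum-cong (λ j → sym (-1*x≈-x _)))
    (trans (altSum-scale (- 1#) t) (-1*x≈-x _))

  -- The sign (-1)^j, which the recursion of `altSum` leaves implicit. It turns an alternating sum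
  -- into a plain `sum`, to which the library's lemmas apply.
  sgn : Fin n → Carrier
  sgn zero    = 1#
  sgn (suc j) = - sgn j

  opaque
    unfolding altSum
    altSum≈sum : (t : Row n) → altSum t ≈ sum (λ j → sgn j * t j)
    altSum≈sum {zero}  t = refl
    altSum≈sum {suc n} t = +-cong (sym (*-identityˡ _))
      (trans (trans (sym (altSum-neg (tail t))) (altSum≈sum (λ j → - t (suc j))))
        (sum-cong-≋ {n} (λ j → solve 2 (λ s t → s :* (:- t) := (:- s) :* t) refl (sgn j) (t (suc j)))))

  opaque
    det : (Fin n → Row n) → Carrier
    det {zero}  M = 1#
    det {suc n} M = altSum (λ j → M zero j * det (λ r s → M (suc r) (punchIn j s)))

    det-zero : (M : Fin 0 → Row 0) → det M ≈ 1#
    det-zero M = refl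

    det-suc : (M : Fin (suc n) → Row (suc n)) →
      det M ≈ altSum (λ j → M zero j * det (λ r s → M (suc r) (punchIn j s)))
    det-suc M = refl

    det-cong : {M N : Fin n → Row n} → (∀ i → M i ≋ N i) → det M ≈ det N
    det-cong {zero}  M≋N = refl
    det-cong {suc n} M≋N = altSum-cong (λ j → *-cong (M≋N zero j)
      (det-cong {n} (λ r s → M≋N (suc r) (punchIn j s))))

  -- The number of rows n and their length m are independent, because fixing the first row lowers n
  -- but leaves m.
  Form : ℕ → ℕ → Set c
  Form n m = (Fin n → Row m) → Carrier

  Extensional : Form n m → Set (c ⊔ ℓ)
  Extensional D = ∀ {M N} → (∀ i → M i ≋ N i) → D M ≈ D N

  Linear : (Row m → Carrier) → Set (c ⊔ ℓ)
  Linear L = ∀ a u v → L (λ j → a * u j + v j) ≈ a * L u + L v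

  -- Each clause speaks about the first row only; the other rows are reached by
  -- fixing the first one.
  IsAlternating : ∀ n → Form n m → Set (c ⊔ ℓ)
  IsAlternating zero    D = ⊤
  IsAlternating (suc n) D =
    (∀ N → Linear (λ u → D (u ∷ N))) ×
    (∀ N i → D (N i ∷ N) ≈ 0#) ×
    (∀ v → IsAlternating n (λ N → D (v ∷ N)))

  ∷-cong : {u v : Row m} {M N : Fin n → Row m} → u ≋ v → (∀ i → M i ≋ N i) → ∀ i → (u ∷ M) i ≋ (v ∷ N) i
  ∷-cong u≋v M≋N zero    = u≋v
  ∷-cong u≋v M≋N (suc i) = M≋N i

  ∷-η : (M : Fin (suc n) → Row m) → ∀ i → M i ≋ (head M ∷ tail M) i
  ∷-η M zero    j = refl
  ∷-η M (suc i) j = refl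

  ≋-refl : {u : Row n} → u ≋ u
  ≋-refl i = refl

  ∷-ext : {D : Form (suc n) m} → Extensional D → ∀ v → Extensional (λ N → D (v ∷ N))
  ∷-ext ext v M≋N = ext (∷-cong ≋-refl M≋N)

  alternating-resp : {D E : Form n m} → (∀ N → D N ≈ E N) → IsAlternating n D → IsAlternating n E
  alternating-resp {zero} D≈E _ = _
  alternating-resp {suc n} D≈E (lin , alt , rest) =
    (λ N a u v → trans (sym (D≈E _)) (trans (lin N a u v) (+-cong (*-congˡ (D≈E _)) (D≈E _)))) ,
    (λ N i → trans (sym (D≈E _)) (alt N i)) ,
    (λ v → alternating-resp (λ N → D≈E (v ∷ N)) (rest v))

  -- Applies a linear map to every row. It serves for the deletion of a column (minors), the
  -- insertion of a zero column, and multiplication by a fixed matrix.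
  alternating-map : {D : Form n m} (f : Row k → Row m) →
    (∀ {u v} → u ≋ v → f u ≋ f v) →
    (∀ a u v → f (λ j → a * u j + v j) ≋ (λ j → a * f u j + f v j)) →
    Extensional D → IsAlternating n D → IsAlternating n (λ N → D (f ∘ N))
  alternating-map {zero} f f-cong f-lin ext _ = _
  alternating-map {suc n} {D = D} f f-cong f-lin ext (lin , alt , rest) =
    (λ N a u v → begin
      D (f ∘ ((λ j → a * u j + v j) ∷ N))           ≈⟨ ext (map-∷ _ N) ⟩
      D (f (λ j → a * u j + v j) ∷ (f ∘ N))         ≈⟨ ext (∷-cong (f-lin a u v) (λ _ → ≋-refl)) ⟩
      D ((λ j → a * f u j + f v j) ∷ (f ∘ N))       ≈⟨ lin (f ∘ N) a (f u) (f v) ⟩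
      a * D (f u ∷ (f ∘ N)) + D (f v ∷ (f ∘ N))     ≈⟨ +-cong (*-congˡ (ext (map-∷ u N))) (ext (map-∷ v N)) ⟨
      a * D (f ∘ (u ∷ N)) + D (f ∘ (v ∷ N))         ∎) ,
    (λ N i → trans (ext (map-∷ (N i) N)) (alt (f ∘ N) i)) ,
    (λ v → alternating-resp (λ N → sym (ext (map-∷ v N)))
      (alternating-map f f-cong f-lin (∷-ext ext (f v)) (rest (f v))))
    where
    map-∷ : ∀ v N → ∀ i → f ((v ∷ N) i) ≋ (f v ∷ (f ∘ N)) i
    map-∷ v N zero    = ≋-refl
    map-∷ v N (suc i) = ≋-refl

  -- With the first row `a` fixed, a Laplace expansion is such a combination of minors; this gives
  -- the alternation in the rows below.
  alternating-altSum : (a : Row k) {D : Fin k → Form n m} → (∀ j → IsAlternating n (D j)) →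
    IsAlternating n (λ N → altSum (λ j → a j * D j N))
  alternating-altSum {n = zero} a _ = _
  alternating-altSum {n = suc n} a {D} alts =
    (λ N b u v → begin
      altSum (λ j → a j * D j ((λ s → b * u s + v s) ∷ N))
        ≈⟨ altSum-cong (λ j → trans (*-congˡ (proj₁ (alts j) N b u v))
             (solve 4 (λ a b x y → a :* (b :* x :+ y) := b :* (a :* x) :+ a :* y) refl _ _ _ _)) ⟩
      altSum (λ j → b * (a j * D j (u ∷ N)) + a j * D j (v ∷ N))
        ≈⟨ altSum-linear b _ _ ⟩
      b * altSum (λ j → a j * D j (u ∷ N)) + altSum (λ j → a j * D j (v ∷ N)) ∎) ,
    (λ N i → altSum-zero (λ j → trans (*-congˡ (proj₁ (proj₂ (alts j)) N i)) (zeroʳ _))) ,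
    (λ v → alternating-altSum a (λ j → proj₂ (proj₂ (alts j)) v))

  -- In a double Laplace expansion the terms for the columns (a , b) and (b , a)
  -- have opposite signs.
  double-altSum : ∀ n (H : Fin (2 ℕ.+ n) → Fin (2 ℕ.+ n) → (Fin n → Fin (2 ℕ.+ n)) → Carrier) →
    (∀ a b e → H a b e ≈ H b a e) →
    (∀ a b {e e′} → (∀ s → e s ≡ e′ s) → H a b e ≈ H a b e′) →
    altSum (λ j → altSum (λ k → H j (punchIn j k) (λ s → punchIn j (punchIn k s)))) ≈ 0#
  double-altSum n H H-sym H-cong = begin
    altSum (λ j → altSum (λ k → H j (punchIn j k) (λ s → punchIn j (punchIn k s))))
      ≈⟨ altSum-suc _ ⟩
    altSum (λ k → H zero (suc k) (λ s → suc (punchIn k s)))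
      - altSum (λ j → altSum (λ k → H (suc j) (punchIn (suc j) k) (λ s → punchIn (suc j) (punchIn k s))))
      ≈⟨ +-congˡ (-‿cong (altSum-cong (λ j → altSum-suc _))) ⟩
    altSum (λ k → H zero (suc k) (λ s → suc (punchIn k s))) - altSum (λ j → X j - Y j)
      -- By symmetry the terms whose first column is 0 equal the terms `X` whose second column is 0,
      -- and these come with the opposite sign.
      ≈⟨ +-cong (altSum-cong (λ k → H-sym zero (suc k) _)) (-‿cong (trans (altSum-+ X (λ j → - Y j)) (+-congˡ (altSum-neg Y)))) ⟩
    altSum X - (altSum X - altSum Y)
      ≈⟨ solve 2 (λ x y → x :- (x :- y) := y) refl _ _ ⟩
    altSum Y ≈⟨ Y≈0 n H H-sym H-cong ⟩
    0# ∎
    where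
    X Y : Fin (suc n) → Carrier
    X j = H (suc j) zero (λ s → suc (punchIn j s))
    Y j = altSum (λ k → H (suc j) (suc (punchIn j k)) (λ s → punchIn (suc j) (punchIn (suc k) s)))

    Y≈0 : ∀ n (H : Fin (2 ℕ.+ n) → Fin (2 ℕ.+ n) → (Fin n → Fin (2 ℕ.+ n)) → Carrier) →
      (∀ a b e → H a b e ≈ H b a e) →
      (∀ a b {e e′} → (∀ s → e s ≡ e′ s) → H a b e ≈ H a b e′) →
      altSum {suc n} (λ j → altSum {n} (λ k → H (suc j) (suc (punchIn j k)) (λ s → punchIn (suc j) (punchIn (suc k) s)))) ≈ 0#
    Y≈0 zero    H H-sym H-cong = altSum-zero (λ j → altSum-zero (λ ()))
    Y≈0 (suc n) H H-sym H-cong = trans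
      (altSum-cong (λ j → altSum-cong (λ k → H-cong _ _ (λ { zero → ≡.refl ; (suc s) → ≡.refl }))))
      -- The pairs avoiding column 0 form the same sum with one column fewer; column 0 has joined
      -- the remaining columns, whence `lift-suc`.
      (double-altSum n (λ a b e → H (suc a) (suc b) (lift-suc e)) (λ a b e → H-sym _ _ _)
        (λ a b e≡e′ → H-cong _ _ (λ { zero → ≡.refl ; (suc s) → ≡.cong suc (e≡e′ s) })))
      where
      lift-suc : (Fin n → Fin (2 ℕ.+ n)) → Fin (suc n) → Fin (3 ℕ.+ n)
      lift-suc e zero    = zero
      lift-suc e (suc s) = suc (e s)

  det-expand² : (u v : Row (2 ℕ.+ n)) (N : Fin n → Row (2 ℕ.+ n)) →
    det (u ∷ (v ∷ N)) ≈ altSum (λ j → altSum (λ k → u j * v (punchIn j k) * det (λ r s → N r (punchIn j (punchIn k s)))))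
  det-expand² u v N = trans (det-suc _) (altSum-cong (λ j → trans (*-congˡ (det-suc _))
    (trans (sym (altSum-scale (u j) _)) (altSum-cong (λ k → sym (*-assoc _ _ _))))))

  det-repeat : (u : Row (2 ℕ.+ n)) (N : Fin n → Row (2 ℕ.+ n)) → det (u ∷ (u ∷ N)) ≈ 0#
  det-repeat {n} u N = trans (det-expand² u u N)
    (double-altSum n (λ a b e → u a * u b * det (λ r s → N r (e s)))
      (λ a b e → *-congʳ (*-comm _ _))
      (λ a b e≡e′ → *-congˡ (det-cong (λ r s → reflexive (≡.cong (N r) (e≡e′ s))))))

  -- The sum of the two expansions has coefficients u a v b + v a u b, symmetric in the columns, so
  -- `double-altSum` applies. For u = v this says only that twice the determinant vanishes; hence
  -- `det-repeat` has its own proof.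
  det-swap : (u v : Row (2 ℕ.+ n)) (N : Fin n → Row (2 ℕ.+ n)) → det (u ∷ (v ∷ N)) + det (v ∷ (u ∷ N)) ≈ 0#
  det-swap {n} u v N = begin
    det (u ∷ (v ∷ N)) + det (v ∷ (u ∷ N))
      ≈⟨ +-cong (det-expand² u v N) (det-expand² v u N) ⟩
    altSum (λ j → altSum (x u v j)) + altSum (λ j → altSum (x v u j))
      ≈⟨ altSum-+ (λ j → altSum (x u v j)) (λ j → altSum (x v u j)) ⟨
    altSum (λ j → altSum (x u v j) + altSum (x v u j))
      ≈⟨ altSum-cong (λ j → trans (sym (altSum-+ (x u v j) (x v u j))) (altSum-cong (λ k → sym (distribʳ _ _ _)))) ⟩
    altSum (λ j → altSum (λ k → (u j * v (punchIn j k) + v j * u (punchIn j k)) * det (λ r s → N r (punchIn j (punchIn k s)))))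
      ≈⟨ double-altSum n (λ a b e → (u a * v b + v a * u b) * det (λ r s → N r (e s)))
           (λ a b e → *-congʳ (solve 4 (λ ua ub va vb → ua :* vb :+ va :* ub := ub :* va :+ vb :* ua) refl _ _ _ _))
           (λ a b e≡e′ → *-congˡ (det-cong (λ r s → reflexive (≡.cong (N r) (e≡e′ s))))) ⟩
    0# ∎
    where
    x : (u v : Row (2 ℕ.+ n)) → Fin (2 ℕ.+ n) → Fin (suc n) → Carrier
    x u v j k = u j * v (punchIn j k) * det (λ r s → N r (punchIn j (punchIn k s)))

  det-alternating : ∀ n → IsAlternating n (det {n})
  det-alternating zero    = _
  det-alternating (suc n) =
    (λ N a u v → begin
      det ((λ j → a * u j + v j) ∷ N)
        ≈⟨ det-suc _ ⟩
      altSum (λ j → (a * u j + v j) * det (λ r s → N r (punchIn j s)))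
        ≈⟨ altSum-cong (λ j → solve 4 (λ a x y d → (a :* x :+ y) :* d := a :* (x :* d) :+ y :* d) refl a (u j) (v j) _) ⟩
      altSum (λ j → a * (u j * det (λ r s → N r (punchIn j s))) + v j * det (λ r s → N r (punchIn j s)))
        ≈⟨ altSum-linear a _ _ ⟩
      a * altSum (λ j → u j * det (λ r s → N r (punchIn j s))) + altSum (λ j → v j * det (λ r s → N r (punchIn j s)))
        ≈⟨ +-cong (*-congˡ (det-suc _)) (det-suc _) ⟨
      a * det (u ∷ N) + det (v ∷ N) ∎) ,
    repeat n (det-alternating n) ,
    (λ v → alternating-resp (λ N → sym (det-suc _)) (alternating-altSum v (λ j → alternating-map (λ u s → u (punchIn j s))
      (λ u≋v s → u≋v (punchIn j s)) (λ a u v s → refl) det-cong (det-alternating n))))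
    where
    repeat : ∀ n → IsAlternating n (det {n}) → ∀ (N : Fin n → Row (suc n)) i → det (N i ∷ N) ≈ 0#
    repeat (suc n) alt N zero = trans (det-cong (∷-cong ≋-refl (∷-η N))) (det-repeat (N zero) (tail N))
    -- The row equal to the first lies below the second one. After exchanging the first two rows,
    -- every minor of the expansion contains both equal rows.
    repeat (suc n) (_ , alt , _) N (suc i) = begin
      det (N (suc i) ∷ N)
        ≈⟨ det-cong (∷-cong ≋-refl (∷-η N)) ⟩
      det (N (suc i) ∷ (head N ∷ tail N))
        ≈⟨ solve 2 (λ x y → x := (x :+ y) :- y) refl _ _ ⟩
      (det (N (suc i) ∷ (head N ∷ tail N)) + det (head N ∷ (N (suc i) ∷ tail N))) - det (head N ∷ (N (suc i) ∷ tail N))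
        ≈⟨ +-cong (det-swap (N (suc i)) (head N) (tail N)) (-‿cong (trans (det-suc _) (altSum-zero (λ j → trans (*-congˡ
             (trans (det-cong (λ { zero _ → refl ; (suc _) _ → refl })) (alt (λ r s → N (suc r) (punchIn j s)) i))) (zeroʳ _))))) ⟩
      0# - 0# ≈⟨ -‿inverseʳ 0# ⟩
      0# ∎

-- Uniqueness of alternating forms and multiplicativity of the determinant.

module Multiplicativity {c ℓ} (R : CommutativeRing c ℓ) where
  open CommutativeRing R hiding (zero)
  open import Data.Vec.Functional using (_∷_)
  open RingSolver R
  open Determinant R
  open import Relation.Binary.Reasoning.Setoid setoid

  private
    Row : ℕ → Set c
    Row = Vector Carrier

    variable
      m n k : ℕ

  -- Row by row, linearity splits off the multiple of `r`, which `kills` annihilates. Applied to a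
  -- form with first row `δ j` fixed and r = `δ j`, it erases column j from the other rows.
  alternating-clear : {D : Form n m} → Extensional D → IsAlternating n D → (r : Row m) →
    (∀ N i → N i ≋ r → D N ≈ 0#) → ∀ (a : Row n) N → D (λ i j → a i * r j + N i j) ≈ D N
  alternating-clear {zero}  ext _ r kills a N = ext (λ ())
  alternating-clear {suc n} {D = D} ext (lin , _ , rest) r kills a N = begin
    D (λ i j → a i * r j + N i j)
      ≈⟨ ext (∷-η _) ⟩
    D ((λ j → a zero * r j + N zero j) ∷ N′)
      ≈⟨ lin N′ (a zero) r (N zero) ⟩
    a zero * D (r ∷ N′) + D (N zero ∷ N′)
      ≈⟨ +-congʳ (trans (*-congˡ (kills _ zero ≋-refl)) (zeroʳ _)) ⟩
    0# + D (N zero ∷ N′)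
      ≈⟨ +-identityˡ _ ⟩
    D (N zero ∷ N′)
      ≈⟨ alternating-clear {D = λ M → D (N zero ∷ M)} (∷-ext ext (N zero)) (rest (N zero)) r
           (λ M i Mi≋r → kills _ (suc i) Mi≋r) (tail a) (tail N) ⟩
    D (N zero ∷ tail N)
      ≈⟨ ext (∷-η N) ⟨
    D N ∎
    where
    N′ = λ i j → a (suc i) * r j + N (suc i) j

  ∷-updateAt : (N : Fin (suc n) → Row m) (i : Fin n) (u : Row m) →
    ∀ k → updateAt N (suc i) (const u) k ≋ (head N ∷ updateAt (tail N) i (const u)) k
  ∷-updateAt N i u zero    = ≋-refl
  ∷-updateAt N i u (suc k) = ≋-refl

  updateAt-+ : {D : Form n m} → Extensional D → IsAlternating n D → ∀ N i (u v : Row m) →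
    D (updateAt N i (const (λ j → u j + v j))) ≈ D (updateAt N i (const u)) + D (updateAt N i (const v))
  updateAt-+ {suc n} {D = D} ext (lin , _) N zero u v = begin
    D (updateAt N zero (const (λ j → u j + v j)))
      ≈⟨ ext (∷-η _) ⟩
    D ((λ j → u j + v j) ∷ tail N)
      ≈⟨ ext (∷-cong (λ j → +-congʳ (sym (*-identityˡ _))) (λ _ → ≋-refl)) ⟩
    D ((λ j → 1# * u j + v j) ∷ tail N)
      ≈⟨ lin (tail N) 1# u v ⟩
    1# * D (u ∷ tail N) + D (v ∷ tail N)
      ≈⟨ +-cong (trans (*-identityˡ _) (sym (ext (∷-η _)))) (sym (ext (∷-η _))) ⟩
    D (updateAt N zero (const u)) + D (updateAt N zero (const v)) ∎
  updateAt-+ {suc n} {D = D} ext (_ , _ , rest) N (suc i) u v = begin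
    D (updateAt N (suc i) (const (λ j → u j + v j)))
      ≈⟨ ext (∷-updateAt N i _) ⟩
    D (head N ∷ updateAt (tail N) i (const (λ j → u j + v j)))
      ≈⟨ updateAt-+ {D = λ M → D (head N ∷ M)} (∷-ext ext (head N)) (rest (head N)) (tail N) i u v ⟩
    D (head N ∷ updateAt (tail N) i (const u)) + D (head N ∷ updateAt (tail N) i (const v))
      ≈⟨ +-cong (ext (∷-updateAt N i u)) (ext (∷-updateAt N i v)) ⟨
    D (updateAt N (suc i) (const u)) + D (updateAt N (suc i) (const v)) ∎

  updateAt-hit : (N : Fin n → Row m) (i : Fin n) (u : Row m) → updateAt N i (const u) i ≋ u
  updateAt-hit N zero    u = ≋-refl
  updateAt-hit N (suc i) u = updateAt-hit (tail N) i u

  updateAt-same : (N : Fin n → Row m) (i : Fin n) → ∀ k → updateAt N i (const (N i)) k ≋ N k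
  updateAt-same N zero    zero    = ≋-refl
  updateAt-same N zero    (suc k) = ≋-refl
  updateAt-same N (suc i) zero    = ≋-refl
  updateAt-same N (suc i) (suc k) = updateAt-same (tail N) i k

  -- Polarisation: the form vanishes with v + w in both places, and the terms with v twice and w
  -- twice vanish as well.
  alternating-swap : {D : Form (suc n) m} → Extensional D → IsAlternating (suc n) D → ∀ v N i →
    D (N i ∷ updateAt N i (const v)) ≈ - D (v ∷ N)
  alternating-swap {D = D} ext (lin , alt , rest) v N i = begin
    f w v
      ≈⟨ solve 4 (λ x y z t → x := (y :+ z :+ (x :+ t)) :- y :- z :- t) refl (f w v) (f v v) (f v w) (f w w) ⟩
    (f v v + f v w + (f w v + f w w)) - f v v - f v w - f w w
      ≈⟨ +-cong (+-cong (+-cong total (-‿cong (f-diagonal v))) (-‿cong (ext (∷-cong ≋-refl (updateAt-same N i))))) (-‿cong (f-diagonal w)) ⟩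
    0# - 0# - D (v ∷ N) - 0#
      ≈⟨ solve 1 (λ x → :0 :- :0 :- x :- :0 := :- x) refl _ ⟩
    - D (v ∷ N) ∎
    where
    w = N i

    f : Row _ → Row _ → Carrier
    f x y = D (x ∷ updateAt N i (const y))

    f-diagonal : ∀ x → f x x ≈ 0#
    f-diagonal x = trans (ext (∷-cong (λ j → sym (updateAt-hit N i x j)) (λ _ → ≋-refl))) (alt (updateAt N i (const x)) i)

    f-+ʳ : ∀ x → f x (λ j → v j + w j) ≈ f x v + f x w
    f-+ʳ x = updateAt-+ {D = λ M → D (x ∷ M)} (∷-ext ext x) (rest x) N i v w

    total : f v v + f v w + (f w v + f w w) ≈ 0#
    total = begin
      f v v + f v w + (f w v + f w w)
        ≈⟨ +-cong (f-+ʳ v) (f-+ʳ w) ⟨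
      f v (λ j → v j + w j) + f w (λ j → v j + w j)
        ≈⟨ +-congʳ (*-identityˡ _) ⟨
      1# * f v (λ j → v j + w j) + f w (λ j → v j + w j)
        ≈⟨ lin _ 1# v w ⟨
      f (λ j → 1# * v j + w j) (λ j → v j + w j)
        ≈⟨ ext (∷-cong (λ j → +-congʳ (*-identityˡ _)) (λ _ → ≋-refl)) ⟩
      f (λ j → v j + w j) (λ j → v j + w j)
        ≈⟨ f-diagonal _ ⟩
      0# ∎

  linear-expand : (L : Row m → Carrier) → (∀ {u v} → u ≋ v → L u ≈ L v) → Linear L →
    ∀ v → L v ≈ sum (λ j → v j * L (δ j))
  linear-expand {zero} L L-cong L-lin v = begin
    -- All rows of length 0 are equal, so linearity with the coefficient -1 yields L v = - L v + L v
    -- = 0. Linearity in the form a u + v has no separate clause for zero.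
    L v                                   ≈⟨ L-cong (λ ()) ⟩
    L (λ j → - 1# * v j + v j)            ≈⟨ L-lin (- 1#) v v ⟩
    - 1# * L v + L v                      ≈⟨ solve 1 (λ x → :- :1 :* x :+ x := :0) refl (L v) ⟩
    0# ∎
  linear-expand {suc m} L L-cong L-lin v = begin
    L v
      ≈⟨ L-cong (λ { zero → solve 1 (λ x → x := x :* :1 :+ :0) refl (v zero)
                   ; (suc j) → solve 2 (λ x y → x := y :* :0 :+ x) refl (v (suc j)) (v zero) }) ⟩
    L (λ j → v zero * δ zero j + (0# ∷ tail v) j)
      ≈⟨ L-lin (v zero) (δ zero) (0# ∷ tail v) ⟩
    v zero * L (δ zero) + L (0# ∷ tail v)
      ≈⟨ +-congˡ (linear-expand (λ u → L (0# ∷ u))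
           (λ u≋v → L-cong (λ { zero → refl ; (suc j) → u≋v j }))
           (λ a u v → trans (L-cong (λ { zero → solve 1 (λ a → :0 := a :* :0 :+ :0) refl a ; (suc j) → refl }))
              (L-lin a (0# ∷ u) (0# ∷ v)))
           (tail v)) ⟩
    v zero * L (δ zero) + sum (λ j → v (suc j) * L (0# ∷ δ j))
      ≈⟨ +-congˡ (sum-cong-≋ {m} (λ j → *-congˡ (L-cong (λ { zero → refl ; (suc k) → refl })))) ⟩
    v zero * L (δ zero) + sum (λ j → v (suc j) * L (δ (suc j))) ∎

  -- Undoes the deletion of column j except for the entry lost there. Through it, a form with first
  -- row `δ j` becomes a form in the rows of the j-th minor.
  insert0 : Fin (suc n) → Row n → Row (suc n)
  insert0 j u = insertAt u j 0#

  insert0-cong : (j : Fin (suc n)) {u v : Row n} → u ≋ v → insert0 j u ≋ insert0 j v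
  insert0-cong         zero    u≋v zero    = refl
  insert0-cong         zero    u≋v (suc k) = u≋v k
  insert0-cong {suc n} (suc j) u≋v zero    = u≋v zero
  insert0-cong {suc n} (suc j) u≋v (suc k) = insert0-cong j (λ i → u≋v (suc i)) k

  insert0-linear : (j : Fin (suc n)) → ∀ a (u v : Row n) →
    insert0 j (λ s → a * u s + v s) ≋ (λ s → a * insert0 j u s + insert0 j v s)
  insert0-linear         zero    a u v zero    = solve 1 (λ a → :0 := a :* :0 :+ :0) refl a
  insert0-linear         zero    a u v (suc k) = refl
  insert0-linear {suc n} (suc j) a u v zero    = refl
  insert0-linear {suc n} (suc j) a u v (suc k) = insert0-linear j a (tail u) (tail v) k

  insert0-removeAt : (j : Fin (suc n)) (u : Row (suc n)) →
    u ≋ (λ s → u j * δ j s + insert0 j (λ t → u (punchIn j t)) s)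
  insert0-removeAt         zero    u zero    = solve 1 (λ x → x := x :* :1 :+ :0) refl (u zero)
  insert0-removeAt         zero    u (suc s) = solve 2 (λ x y → x := y :* :0 :+ x) refl (u (suc s)) (u zero)
  insert0-removeAt {suc n} (suc j) u zero    = solve 2 (λ x y → x := y :* :0 :+ x) refl (u zero) (u (suc j))
  insert0-removeAt {suc n} (suc j) u (suc s) = insert0-removeAt j (tail u) s

  insert0-δ : (j : Fin (suc n)) (r : Fin n) → insert0 j (δ r) ≋ δ (punchIn j r)
  insert0-δ         zero    r       zero    = refl
  insert0-δ         zero    r       (suc s) = refl
  insert0-δ {suc n} (suc j) zero    zero    = refl
  insert0-δ {suc n} (suc j) zero    (suc s) = insert0-zero j s
    where
    insert0-zero : ∀ {n} (j : Fin (suc n)) → insert0 j (λ _ → 0#) ≋ (λ _ → 0#)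
    insert0-zero         zero    zero    = refl
    insert0-zero         zero    (suc s) = refl
    insert0-zero {suc n} (suc j) zero    = refl
    insert0-zero {suc n} (suc j) (suc s) = insert0-zero j s
  insert0-δ {suc n} (suc j) (suc r) zero    = refl
  insert0-δ {suc n} (suc j) (suc r) (suc s) = insert0-δ j r s

  sgn-inject₁ : (j : Fin n) → sgn (inject₁ j) ≡ sgn j
  sgn-inject₁ zero    = ≡.refl
  sgn-inject₁ (suc j) = ≡.cong -_ (sgn-inject₁ j)

  punchIn-suc : (j : Fin n) → punchIn (suc j) j ≡ inject₁ j
  punchIn-suc zero    = ≡.refl
  punchIn-suc (suc j) = ≡.cong suc (punchIn-suc j)

  updateAt-punchIn : (e : Fin (suc n) → Row m) (j : Fin n) →
    ∀ r → updateAt (λ r → e (punchIn (suc j) r)) j (const (e (suc j))) r ≋ e (punchIn (inject₁ j) r)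
  updateAt-punchIn e zero    zero    = ≋-refl
  updateAt-punchIn e zero    (suc r) = ≋-refl
  updateAt-punchIn e (suc j) zero    = ≋-refl
  updateAt-punchIn e (suc j) (suc r) = updateAt-punchIn (tail e) j r

  -- Passing from column j to column j + 1 exchanges the rows δ j and δ (j + 1).
  alternating-δ : {D : Form (suc n) (suc n)} → Extensional D → IsAlternating (suc n) D →
    ∀ j → D (δ j ∷ (λ r → δ (punchIn j r))) ≈ sgn j * D δ
  alternating-δ {n} {D} ext alt = <-weakInduction
    (λ j → D (δ j ∷ (λ r → δ (punchIn j r))) ≈ sgn j * D δ)
    (trans (sym (ext (∷-η δ))) (sym (*-identityˡ _)))
    (λ j ih → begin
      D (δ (suc j) ∷ N j)
        ≈⟨ solve 1 (λ x → x := :- (:- x)) refl _ ⟩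
      - - D (δ (suc j) ∷ N j)
        ≈⟨ -‿cong (alternating-swap ext alt (δ (suc j)) (N j) j) ⟨
      - D (N j j ∷ updateAt (N j) j (const (δ (suc j))))
        ≈⟨ -‿cong (ext (∷-cong (λ s → reflexive (≡.cong (λ i → δ i s) (punchIn-suc j))) (updateAt-punchIn δ j))) ⟩
      - D (δ (inject₁ j) ∷ (λ r → δ (punchIn (inject₁ j) r)))
        ≈⟨ -‿cong ih ⟩
      - (sgn (inject₁ j) * D δ)
        ≈⟨ -‿cong (*-congʳ (reflexive (sgn-inject₁ j))) ⟩
      - (sgn j * D δ)
        ≈⟨ solve 2 (λ x y → :- (x :* y) := (:- x) :* y) refl _ _ ⟩
      - sgn j * D δ ∎)
    where
    N : Fin n → Fin n → Row (suc n)
    N j r = δ (punchIn (suc j) r)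

  -- Expand the first row in the basis `δ j` and clear column j below it. What is left is an
  -- alternating form in the rows of the minor, so the induction hypothesis gives its determinant
  -- times the value at the identity, and `alternating-δ` evaluates that as the sign times D δ. The
  -- sum is the Laplace expansion.
  alternating-unique : {D : Form n n} → Extensional D → IsAlternating n D → ∀ M → D M ≈ D δ * det M
  alternating-unique {zero}  ext _ M = trans (ext (λ ())) (sym (trans (*-congˡ (det-zero M)) (*-identityʳ _)))
  alternating-unique {suc n} {D} ext alt@(lin , kill , rest) M = begin
    D M
      ≈⟨ ext (∷-η M) ⟩
    D (head M ∷ tail M)
      ≈⟨ linear-expand (λ u → D (u ∷ tail M)) (λ u≋v → ext (∷-cong u≋v (λ _ → ≋-refl))) (lin (tail M)) (head M) ⟩
    sum (λ j → M zero j * D (δ j ∷ tail M))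
      ≈⟨ sum-cong-≋ {suc n} (λ j → trans (*-congˡ (column j))
           (solve 4 (λ x s d e → x :* (s :* d :* e) := d :* (s :* (x :* e))) refl (M zero j) (sgn j) (D δ) _)) ⟩
    sum (λ j → D δ * (sgn j * (M zero j * det (minor j))))
      ≈⟨ *-distribˡ-sum {suc n} (D δ) (λ j → sgn j * (M zero j * det (minor j))) ⟨
    D δ * sum (λ j → sgn j * (M zero j * det (minor j)))
      ≈⟨ *-congˡ (altSum≈sum _) ⟨
    D δ * altSum (λ j → M zero j * det (minor j))
      ≈⟨ *-congˡ (det-suc M) ⟨
    D δ * det M ∎
    where
    minor : Fin (suc n) → Fin n → Row n
    minor j r s = M (suc r) (punchIn j s)

    column : ∀ j → D (δ j ∷ tail M) ≈ sgn j * D δ * det (minor j)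
    column j = begin
      D (δ j ∷ tail M)
        ≈⟨ ∷-ext ext (δ j) (λ r → insert0-removeAt j (M (suc r))) ⟩
      D (δ j ∷ (λ r s → M (suc r) j * δ j s + insert0 j (minor j r) s))
        ≈⟨ alternating-clear {D = λ N → D (δ j ∷ N)} (∷-ext ext (δ j)) (rest (δ j)) (δ j)
             (λ N i Ni≋δ → trans (ext (∷-cong (λ s → sym (Ni≋δ s)) (λ _ → ≋-refl))) (kill N i))
             (λ r → M (suc r) j) (λ r → insert0 j (minor j r)) ⟩
      D (δ j ∷ (λ r → insert0 j (minor j r)))
        ≈⟨ alternating-unique {D = λ N → D (δ j ∷ (λ r → insert0 j (N r)))}
             (λ M≋N → ∷-ext ext (δ j) (λ r → insert0-cong j (M≋N r)))
             (alternating-map {D = λ N → D (δ j ∷ N)} (insert0 j) (insert0-cong j) (insert0-linear j) (∷-ext ext (δ j)) (rest (δ j)))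
             (minor j) ⟩
      D (δ j ∷ (λ r → insert0 j (δ r))) * det (minor j)
        ≈⟨ *-congʳ (trans (∷-ext ext (δ j) (insert0-δ j)) (alternating-δ ext alt j)) ⟩
      sgn j * D δ * det (minor j) ∎

  infixl 7 _⊡_
  _⊡_ : (Fin m → Row n) → (Fin n → Row k) → Fin m → Row k
  (M ⊡ N) i k = sum (λ j → M i j * N j k)

  sum-zero : ∀ n → {t : Row n} → (∀ j → t j ≈ 0#) → sum t ≈ 0#
  sum-zero n t≈0 = trans (sum-cong-≋ {n} t≈0) (sum-replicate-zero n)

  sum-δ : (i : Fin n) (u : Row n) → sum (λ j → δ i j * u j) ≈ u i
  sum-δ {suc n} zero u = trans (+-cong (*-identityˡ _) (sum-zero n (λ j → zeroˡ _))) (+-identityʳ _)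
  sum-δ {suc n} (suc i) u = trans (+-cong (zeroˡ _) (sum-δ i (tail u))) (+-identityˡ _)

  -- As a function of the rows of `M` the left side is alternating, and its value at the identity is
  -- det N.
  det-⊡ : (M N : Fin n → Row n) → det (M ⊡ N) ≈ det M * det N
  det-⊡ {n} M N = begin
    det (M ⊡ N)
      ≈⟨ alternating-unique {D = λ M → det (M ⊡ N)}
           (λ M≋M′ → det-cong (λ i → times-cong (M≋M′ i)))
           (alternating-map times times-cong times-linear det-cong (det-alternating n)) M ⟩
    det (δ ⊡ N) * det M
      ≈⟨ *-congʳ (det-cong (λ i k → sum-δ i (λ j → N j k))) ⟩
    det N * det M
      ≈⟨ *-comm _ _ ⟩
    det M * det N ∎
    where
    times : Row n → Row n
    times u k = sum (λ j → u j * N j k)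

    times-cong : ∀ {u v} → u ≋ v → times u ≋ times v
    times-cong u≋v k = sum-cong-≋ {n} (λ j → *-congʳ (u≋v j))

    times-linear : ∀ a u v → times (λ j → a * u j + v j) ≋ (λ k → a * times u k + times v k)
    times-linear a u v k = begin
      sum (λ j → (a * u j + v j) * N j k)
        ≈⟨ sum-cong-≋ {n} (λ j → solve 4 (λ a u v x → (a :* u :+ v) :* x := a :* (u :* x) :+ v :* x) refl a (u j) (v j) (N j k)) ⟩
      sum (λ j → a * (u j * N j k) + v j * N j k)
        ≈⟨ ∑-distrib-+ {n} _ _ ⟩
      sum (λ j → a * (u j * N j k)) + times v k
        ≈⟨ +-congʳ (sym (*-distribˡ-sum {n} a _)) ⟩
      a * times u k + times v k ∎

-- Determinants of block triangular matrices and Kronecker products.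

module BlockMatrices {c ℓ} (R : CommutativeRing c ℓ) where
  open CommutativeRing R hiding (zero)
  open RingSolver R
  open Determinant R
  open Multiplicativity R
  open import Relation.Binary.Reasoning.Setoid setoid
  open import Algebra.Properties.Ring ring using (-0#≈0#)

  private
    variable
      m n k : ℕ

    Mat : ℕ → ℕ → Set c
    Mat m n = Fin m → Vector Carrier n

    -- Stated on the sum type, apart from `splitAt`, so that an equation for `splitAt` can be
    -- applied to one index at a time.
    blocks : Mat m m → Mat m n → Mat n m → Mat n n → Fin m ⊎ Fin n → Fin m ⊎ Fin n → Carrier
    blocks P Q S T (inj₁ i) (inj₁ j) = P i j
    blocks P Q S T (inj₁ i) (inj₂ v) = Q i v
    blocks P Q S T (inj₂ u) (inj₁ j) = S u j
    blocks P Q S T (inj₂ u) (inj₂ v) = T u v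

  block : Mat m m → Mat m n → Mat n m → Mat n n → Mat (m ℕ.+ n) (m ℕ.+ n)
  block {m} P Q S T i j = blocks P Q S T (splitAt m i) (splitAt m j)

  𝟎 : Mat m n
  𝟎 i j = 0#

  altSum-block : ∀ m (t : Vector Carrier (m ℕ.+ n)) → (∀ v → t (m ↑ʳ v) ≈ 0#) →
    altSum t ≈ altSum (λ i → t (i ↑ˡ n))
  altSum-block zero    t t≈0 = trans (altSum-zero t≈0) (sym (altSum-zero {0} (λ ())))
  altSum-block (suc m) t t≈0 = trans (altSum-suc t)
    (trans (+-congˡ (-‿cong (altSum-block m (λ i → t (suc i)) t≈0))) (sym (altSum-suc _)))

  sum-block : ∀ m (t : Vector Carrier (m ℕ.+ n)) →
    sum t ≈ sum (λ i → t (i ↑ˡ n)) + sum (λ v → t (m ↑ʳ v))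
  sum-block zero    t = sym (+-identityˡ _)
  sum-block (suc m) t = trans (+-congˡ (sum-block m (λ i → t (suc i)))) (sym (+-assoc _ _ _))

  splitAt-punchIn : ∀ (j : Fin (suc m)) (s : Fin (m ℕ.+ n)) →
    splitAt (suc m) (punchIn (j ↑ˡ n) s) ≡ Sum.map₁ (punchIn j) (splitAt m s)
  splitAt-punchIn {m}     zero    s       = ≡.refl
  splitAt-punchIn {suc m} (suc j) zero    = ≡.refl
  splitAt-punchIn {suc m} (suc j) (suc s) rewrite splitAt-punchIn j s with splitAt m s
  ... | inj₁ _ = ≡.refl
  ... | inj₂ _ = ≡.refl

  -- The first row is zero beyond the columns of `P`, so only these contribute to the expansion, and
  -- each minor again has this block form.
  det-block-lower : ∀ (P : Mat m m) (S : Mat n m) (T : Mat n n) →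
    det (block P 𝟎 S T) ≈ det P * det T
  det-block-lower {zero}  P S T = sym (trans (*-congʳ (det-zero P)) (*-identityˡ _))
  det-block-lower {suc m} {n} P S T = begin
    det (block P 𝟎 S T)
      ≈⟨ det-suc _ ⟩
    altSum (λ j → blocks P 𝟎 S T (inj₁ zero) (splitAt (suc m) j) * det (minor j))
      ≈⟨ altSum-block (suc m) _ (λ v → trans (*-congʳ (reflexive (≡.cong (blocks P 𝟎 S T (inj₁ zero)) (splitAt-↑ʳ (suc m) n v)))) (zeroˡ _)) ⟩
    altSum (λ j → blocks P 𝟎 S T (inj₁ zero) (splitAt (suc m) (j ↑ˡ n)) * det (minor (j ↑ˡ n)))
      ≈⟨ altSum-cong (λ j → trans (*-cong
           (reflexive (≡.cong (blocks P 𝟎 S T (inj₁ zero)) (splitAt-↑ˡ (suc m) j n)))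
           (trans (det-cong (minor-block j)) (det-block-lower (P′ j) (S′ j) T)))
           (solve 3 (λ p d t → p :* (d :* t) := t :* (p :* d)) refl (P zero j) (det (P′ j)) (det T))) ⟩
    altSum (λ j → det T * (P zero j * det (P′ j)))
      ≈⟨ altSum-scale (det T) _ ⟩
    det T * altSum (λ j → P zero j * det (P′ j))
      ≈⟨ *-congˡ (det-suc P) ⟨
    det T * det P
      ≈⟨ *-comm _ _ ⟩
    det P * det T ∎
    where
    minor : Fin (suc m ℕ.+ n) → Mat (m ℕ.+ n) (m ℕ.+ n)
    minor j r s = block P 𝟎 S T (suc r) (punchIn j s)

    P′ : Fin (suc m) → Mat m m
    P′ j r s = P (suc r) (punchIn j s)

    S′ : Fin (suc m) → Mat n m
    S′ j r s = S r (punchIn j s)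

    minor-block : ∀ j r → minor (j ↑ˡ n) r ≋ block (P′ j) 𝟎 (S′ j) T r
    minor-block j r s rewrite splitAt-punchIn {m} {n} j s with splitAt m r | splitAt m s
    ... | inj₁ _ | inj₁ _ = refl
    ... | inj₁ _ | inj₂ _ = refl
    ... | inj₂ _ | inj₁ _ = refl
    ... | inj₂ _ | inj₂ _ = refl

  det-zeroColumn : (M : Mat (suc n) (suc n)) → (∀ i → M i zero ≈ 0#) → det M ≈ 0#
  det-firstColumn : (M : Mat (suc n) (suc n)) → (∀ i → M (suc i) zero ≈ 0#) →
    det M ≈ M zero zero * det (λ r s → M (suc r) (suc s))

  det-zeroColumn M M≈0 = trans (det-firstColumn M (M≈0 ∘ suc)) (trans (*-congʳ (M≈0 zero)) (zeroˡ _))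

  det-firstColumn {zero} M M≈0 = trans (det-suc M) (trans (altSum-suc _)
    (trans (+-congˡ (trans (-‿cong (altSum-zero {0} (λ ()))) -0#≈0#)) (+-identityʳ _)))
  det-firstColumn {suc n} M M≈0 = trans (det-suc M) (trans (altSum-suc _)
    (trans (+-congˡ (trans (-‿cong (altSum-zero (λ j →
      trans (*-congˡ (det-zeroColumn (λ r s → M (suc r) (punchIn (suc j) s)) M≈0)) (zeroʳ _)))) -0#≈0#))
      (+-identityʳ _)))

  det-block-unitUpper : ∀ m (Q : Mat m n) (T : Mat n n) → det (block δ Q 𝟎 T) ≈ det T
  det-block-unitUpper zero    Q T = refl
  det-block-unitUpper {n} (suc m) Q T = begin
    det (block δ Q 𝟎 T)
      ≈⟨ det-firstColumn _ column ⟩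
    1# * det (λ r s → block δ Q 𝟎 T (suc r) (suc s))
      ≈⟨ *-identityˡ _ ⟩
    det (λ r s → block δ Q 𝟎 T (suc r) (suc s))
      ≈⟨ det-cong minor ⟩
    det (block δ (λ i → Q (suc i)) 𝟎 T)
      ≈⟨ det-block-unitUpper m _ T ⟩
    det T ∎
    where
    column : ∀ i → block δ Q 𝟎 T (suc i) zero ≈ 0#
    column i with splitAt m i
    ... | inj₁ _ = refl
    ... | inj₂ _ = refl

    minor : ∀ r → (λ s → block δ Q 𝟎 T (suc r) (suc s)) ≋ block δ (λ i → Q (suc i)) 𝟎 T r
    minor r s with splitAt m r | splitAt m s
    ... | inj₁ _ | inj₁ _ = refl
    ... | inj₁ _ | inj₂ _ = refl
    ... | inj₂ _ | inj₁ _ = refl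
    ... | inj₂ _ | inj₂ _ = refl

  block-cong : {P P′ : Mat m m} {Q Q′ : Mat m n} {S S′ : Mat n m} {T T′ : Mat n n} →
    (∀ i → P i ≋ P′ i) → (∀ i → Q i ≋ Q′ i) → (∀ i → S i ≋ S′ i) → (∀ i → T i ≋ T′ i) →
    ∀ i → block P Q S T i ≋ block P′ Q′ S′ T′ i
  block-cong {m} P≋ Q≋ S≋ T≋ i j with splitAt m i | splitAt m j
  ... | inj₁ i | inj₁ j = P≋ i j
  ... | inj₁ i | inj₂ j = Q≋ i j
  ... | inj₂ i | inj₁ j = S≋ i j
  ... | inj₂ i | inj₂ j = T≋ i j

  infixl 6 _⊞_
  _⊞_ : Mat m n → Mat m n → Mat m n
  (M ⊞ N) i j = M i j + N i j

  block-⊡ : (P P′ : Mat m m) (Q Q′ : Mat m n) (S S′ : Mat n m) (T T′ : Mat n n) →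
    ∀ i → (block P Q S T ⊡ block P′ Q′ S′ T′) i ≋
      block (P ⊡ P′ ⊞ Q ⊡ S′) (P ⊡ Q′ ⊞ Q ⊡ T′) (S ⊡ P′ ⊞ T ⊡ S′) (S ⊡ Q′ ⊞ T ⊡ T′) i
  block-⊡ {m} {n} P P′ Q Q′ S S′ T T′ i k = begin
    sum (λ j → entry (splitAt m i) (splitAt m j) (splitAt m k))
      ≈⟨ sum-block m (λ j → entry (splitAt m i) (splitAt m j) (splitAt m k)) ⟩
    sum (λ j → entry (splitAt m i) (splitAt m (j ↑ˡ n)) (splitAt m k)) + sum (λ j → entry (splitAt m i) (splitAt m (m ↑ʳ j)) (splitAt m k))
      ≈⟨ +-cong (sum-cong-≋ {m} (λ j → reflexive (≡.cong (λ x → entry (splitAt m i) x (splitAt m k)) (splitAt-↑ˡ m j n))))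
                (sum-cong-≋ {n} (λ j → reflexive (≡.cong (λ x → entry (splitAt m i) x (splitAt m k)) (splitAt-↑ʳ m n j)))) ⟩
    sum (λ j → entry (splitAt m i) (inj₁ j) (splitAt m k)) + sum (λ j → entry (splitAt m i) (inj₂ j) (splitAt m k))
      ≈⟨ split (splitAt m i) (splitAt m k) ⟩
    block (P ⊡ P′ ⊞ Q ⊡ S′) (P ⊡ Q′ ⊞ Q ⊡ T′) (S ⊡ P′ ⊞ T ⊡ S′) (S ⊡ Q′ ⊞ T ⊡ T′) i k ∎
    where
    entry : Fin m ⊎ Fin n → Fin m ⊎ Fin n → Fin m ⊎ Fin n → Carrier
    entry i j k = blocks P Q S T i j * blocks P′ Q′ S′ T′ j k

    split : ∀ i k → sum (λ j → entry i (inj₁ j) k) + sum (λ j → entry i (inj₂ j) k) ≈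
      blocks (P ⊡ P′ ⊞ Q ⊡ S′) (P ⊡ Q′ ⊞ Q ⊡ T′) (S ⊡ P′ ⊞ T ⊡ S′) (S ⊡ Q′ ⊞ T ⊡ T′) i k
    split (inj₁ i) (inj₁ k) = refl
    split (inj₁ i) (inj₂ k) = refl
    split (inj₂ i) (inj₁ k) = refl
    split (inj₂ i) (inj₂ k) = refl

  ⊡-identityʳ : (M : Mat m n) → ∀ i → (M ⊡ δ) i ≋ M i
  ⊡-identityʳ {n = suc n} M i zero = trans (+-cong (*-identityʳ _) (sum-zero n (λ j → zeroʳ _))) (+-identityʳ _)
  ⊡-identityʳ {n = suc n} M i (suc k) = trans (+-cong (zeroʳ _) (⊡-identityʳ (λ i j → M i (suc j)) i k)) (+-identityˡ _)

  ⊡-zeroʳ : (M : Mat m n) → ∀ i → (M ⊡ 𝟎 {n} {k}) i ≋ 𝟎 {m} i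
  ⊡-zeroʳ {n = n} M i k = sum-zero n (λ j → zeroʳ _)

  ⊡-zeroˡ : (M : Mat n k) → ∀ i → (𝟎 {m} ⊡ M) i ≋ 𝟎 {m} i
  ⊡-zeroˡ {n} M i k = sum-zero n (λ j → zeroˡ _)

  det-δ : ∀ n → det (δ {n}) ≈ 1#
  det-δ zero    = det-zero _
  det-δ (suc n) = trans (det-firstColumn δ (λ i → refl)) (trans (*-identityˡ _) (det-δ n))

  -- Factors the matrix as (1 , Q ; 0 , T) times (P , 0 ; 0 , 1): the first factor is peeled off
  -- column by column, and the second is block lower triangular.
  det-block-upper : ∀ (P : Mat m m) (Q : Mat m n) (T : Mat n n) →
    det (block P Q 𝟎 T) ≈ det P * det T
  det-block-upper {m} {n} P Q T = begin
    det (block P Q 𝟎 T)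
      ≈⟨ det-cong (λ i → λ j → sym (trans (block-⊡ δ P Q 𝟎 𝟎 𝟎 T δ i j) (block-cong
           (λ i j → trans (+-cong (sum-δ i (λ k → P k j)) (⊡-zeroʳ Q i j)) (+-identityʳ _))
           (λ i j → trans (+-cong (sum-δ i (λ k → 0#)) (⊡-identityʳ Q i j)) (+-identityˡ _))
           (λ i j → trans (+-cong (⊡-zeroˡ P i j) (⊡-zeroʳ T i j)) (+-identityˡ _))
           (λ i j → trans (+-cong (⊡-zeroˡ {m} 𝟎 i j) (⊡-identityʳ T i j)) (+-identityˡ _)) i j))) ⟩
    det (block δ Q 𝟎 T ⊡ block P 𝟎 𝟎 δ)
      ≈⟨ det-⊡ _ _ ⟩
    det (block δ Q 𝟎 T) * det (block P 𝟎 𝟎 δ)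
      ≈⟨ *-cong (det-block-unitUpper m Q T) (trans (det-block-lower P 𝟎 δ) (trans (*-congˡ (det-δ n)) (*-identityʳ _))) ⟩
    det T * det P
      ≈⟨ *-comm _ _ ⟩
    det P * det T ∎

  open import Algebra.Properties.CommutativeSemiring.Exp commutativeSemiring public using (_^_; ^-cong)

  -- The tensor product M ⊗ T, with pairs of indices numbered by `remQuot` as in `classify`.
  kronecker : Mat m m → Mat n n → Mat (m ℕ.* n) (m ℕ.* n)
  kronecker {m} {n} M T i j =
    M (proj₁ (remQuot {m} n i)) (proj₁ (remQuot {m} n j)) * T (proj₂ (remQuot {m} n i)) (proj₂ (remQuot {m} n j))

  det-diagonal : ∀ m (T : Mat n n) → det (kronecker {m} δ T) ≈ det T ^ m
  det-diagonal zero    T = det-zero _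
  det-diagonal {n} (suc m) T = begin
    det (kronecker {suc m} δ T)
      ≈⟨ det-cong entries ⟩
    det (block T 𝟎 𝟎 (kronecker {m} δ T))
      ≈⟨ det-block-lower T 𝟎 _ ⟩
    det T * det (kronecker {m} δ T)
      ≈⟨ *-congˡ (det-diagonal m T) ⟩
    det T * det T ^ m ∎
    where
    entries : ∀ i → kronecker {suc m} δ T i ≋ block T 𝟎 𝟎 (kronecker {m} δ T) i
    entries i j with splitAt n i | splitAt n j
    ... | inj₁ _ | inj₁ _ = *-identityˡ _
    ... | inj₁ _ | inj₂ _ = zeroˡ _
    ... | inj₂ _ | inj₁ _ = zeroˡ _
    ... | inj₂ _ | inj₂ _ = refl

  det-scalar : ∀ n a → det {n} (λ i j → a * δ i j) ≈ a ^ n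
  det-scalar zero    a = det-zero _
  det-scalar (suc n) a = trans (det-firstColumn _ (λ i → zeroʳ a)) (*-cong (*-identityʳ a) (det-scalar n a))

-- Homomorphisms, polynomial extensions and quadratic extensions.

open CommutativeRing using (Carrier)

record Hom {c ℓ} (R S : CommutativeRing c ℓ) : Set (c ⊔ ℓ) where
  field
    ⟦_⟧    : Carrier R → Carrier S
    isHom : IsRingHomomorphism (CommutativeRing.rawRing R) (CommutativeRing.rawRing S) ⟦_⟧
  open IsRingHomomorphism isHom public

open Hom using (⟦_⟧)

-- A non-zero-divisor. This suffices for cancelling and survives in quadratic extensions, whereas
-- inverses would have to be adjoined.
Regular : ∀ {c ℓ} (R : CommutativeRing c ℓ) → Carrier R → Set (c ⊔ ℓ)
Regular R u = ∀ t → u * t ≈ 0# → t ≈ 0#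
  where
  open CommutativeRing R

-- An interface to R[X]. The arguments about spectra take it as a parameter, so coefficient lists
-- never unfold in them.
record PolynomialExtension {c ℓ} (R : CommutativeRing c ℓ) : Set (Level.suc (c ⊔ ℓ)) where
  field
    ring     : CommutativeRing c ℓ
    constant : Hom R ring
    X        : Carrier ring
    eval     : ∀ {S : CommutativeRing c ℓ} → Hom R S → Carrier S → Hom ring S
  open CommutativeRing ring using (_≈_; _*_; 0#)
  field
    eval-constant : ∀ {S} (f : Hom R S) a t → CommutativeRing._≈_ S (⟦ eval f a ⟧ (⟦ constant ⟧ t)) (⟦ f ⟧ t)
    eval-X        : ∀ {S} (f : Hom R S) a → CommutativeRing._≈_ S (⟦ eval f a ⟧ X) a
    X-regular     : Regular ring X
    -- The homomorphism is the substitution of u X for X over R; injectivity is expressed by its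
    -- kernel.
    scale-injective : ∀ {u} → Regular R u → ∀ p → ⟦ eval constant (⟦ constant ⟧ u * X) ⟧ p ≈ 0# → p ≈ 0#

-- An interface to R[y] / (y² - s y + t), with y² - s y + t = (y - α)(y - β) by Vieta. This ring is
-- free over R with basis 1, α, which is the source of `regular` and `injective`.
record QuadraticExtension {c ℓ} (R : CommutativeRing c ℓ) (s t : Carrier R) : Set (Level.suc (c ⊔ ℓ)) where
  field
    ring      : CommutativeRing c ℓ
    inclusion : Hom R ring
    α β       : Carrier ring
  open CommutativeRing ring using (_≈_; _+_; _*_)
  field
    α+β       : α + β ≈ ⟦ inclusion ⟧ s
    α*β       : α * β ≈ ⟦ inclusion ⟧ t
    regular   : ∀ {u} → Regular R u → Regular ring (⟦ inclusion ⟧ u)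
    injective : ∀ {x y} → ⟦ inclusion ⟧ x ≈ ⟦ inclusion ⟧ y → CommutativeRing._≈_ R x y

-- A pair (a , b) stands for a + bα, where α² = sα - t; hence β = s - α.
quadraticExtension : ∀ {c ℓ} (R : CommutativeRing c ℓ) s t → QuadraticExtension R s t
quadraticExtension R s t = record
  { ring      = Q
  ; inclusion = record
    { ⟦_⟧   = λ x → x , 0#
    ; isHom = record
      { isSemiringHomomorphism = record
        { isNearSemiringHomomorphism = record
          { +-isMonoidHomomorphism = record
            { isMagmaHomomorphism = record
              { isRelHomomorphism = record { cong = λ x≈y → x≈y , refl }
              ; homo = λ x y → refl , sym (+-identityʳ 0#)
              }
            ; ε-homo = refl , refl
            }
          ; *-homo = λ x y →
              solve 3 (λ x y t → x :* y := x :* y :- t :* (:0 :* :0)) refl x y t ,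
              solve 3 (λ x y s → :0 := x :* :0 :+ :0 :* y :+ s :* (:0 :* :0)) refl x y s
          }
        ; 1#-homo = refl , refl
        }
      ; -‿homo = λ x → refl , solve 0 (:0 := :- :0) refl
      }
    }
  ; α = 0# , 1#
  ; β = s , - 1#
  ; α+β = +-identityˡ s , -‿inverseʳ 1#
  ; α*β = solve 2 (λ s t → :0 :* s :- t :* (:1 :* :- :1) := t) refl s t ,
          solve 1 (λ s → :0 :* :- :1 :+ :1 :* s :+ s :* (:1 :* :- :1) := :0) refl s
  -- Multiplication by an element of the base acts on the two coordinates separately.
  ; regular = λ {u} u-regular (x , y) (p , q) →
      u-regular x (trans (solve 4 (λ u x y t → u :* x := u :* x :- t :* (:0 :* y)) refl u x y t) p) ,
      u-regular y (trans (solve 4 (λ u x y s → u :* y := u :* y :+ :0 :* x :+ s :* (:0 :* y)) refl u x y s) q)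
  ; injective = proj₁
  }
  where
  open CommutativeRing R hiding (zero; Carrier; ring)
  open RingSolver R
  Q : CommutativeRing _ _
  Q = record
    { Carrier = Carrier R × Carrier R
    ; _≈_ = λ (a , b) (a′ , b′) → (a ≈ a′) × (b ≈ b′)
    ; _+_ = λ (a , b) (a′ , b′) → a + a′ , b + b′
    ; _*_ = λ (a , b) (a′ , b′) → a * a′ - t * (b * b′) , a * b′ + b * a′ + s * (b * b′)
    ; -_  = λ (a , b) → - a , - b
    ; 0#  = 0# , 0#
    ; 1#  = 1# , 0#
    ; isCommutativeRing = record
      { isRing = record
        { +-isAbelianGroup = record
          { isGroup = record
            { isMonoid = record
              { isSemigroup = record
                { isMagma = record
                  { isEquivalence = record
                    { refl  = refl , refl
                    ; sym   = λ (p , q) → sym p , sym q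
                    ; trans = λ (p , q) (p′ , q′) → trans p p′ , trans q q′
                    }
                  ; ∙-cong = λ (p , q) (p′ , q′) → +-cong p p′ , +-cong q q′
                  }
                ; assoc = λ (a , b) (c , d) (e , f) → +-assoc a c e , +-assoc b d f
                }
              ; identity = (λ (a , b) → +-identityˡ a , +-identityˡ b) , (λ (a , b) → +-identityʳ a , +-identityʳ b)
              }
            ; inverse = (λ (a , b) → -‿inverseˡ a , -‿inverseˡ b) , (λ (a , b) → -‿inverseʳ a , -‿inverseʳ b)
            ; ⁻¹-cong = λ (p , q) → -‿cong p , -‿cong q
            }
          ; comm = λ (a , b) (c , d) → +-comm a c , +-comm b d
          }
        ; *-cong = λ (p , q) (p′ , q′) →
            +-cong (*-cong p p′) (-‿cong (*-congˡ (*-cong q q′))) ,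
            +-cong (+-cong (*-cong p q′) (*-cong q p′)) (*-congˡ (*-cong q q′))
        ; *-assoc = λ (a , b) (c , d) (e , f) →
            solve 8 (λ a b c d e f s t →
              (a :* c :- t :* (b :* d)) :* e :- t :* ((a :* d :+ b :* c :+ s :* (b :* d)) :* f) :=
              a :* (c :* e :- t :* (d :* f)) :- t :* (b :* (c :* f :+ d :* e :+ s :* (d :* f)))) refl a b c d e f s t ,
            solve 8 (λ a b c d e f s t →
              (a :* c :- t :* (b :* d)) :* f :+ (a :* d :+ b :* c :+ s :* (b :* d)) :* e :+ s :* ((a :* d :+ b :* c :+ s :* (b :* d)) :* f) :=
              a :* (c :* f :+ d :* e :+ s :* (d :* f)) :+ b :* (c :* e :- t :* (d :* f)) :+ s :* (b :* (c :* f :+ d :* e :+ s :* (d :* f)))) refl a b c d e f s t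
        ; *-identity =
            (λ (a , b) → solve 3 (λ a b t → :1 :* a :- t :* (:0 :* b) := a) refl a b t ,
                         solve 3 (λ a b s → :1 :* b :+ :0 :* a :+ s :* (:0 :* b) := b) refl a b s) ,
            (λ (a , b) → solve 3 (λ a b t → a :* :1 :- t :* (b :* :0) := a) refl a b t ,
                         solve 3 (λ a b s → a :* :0 :+ b :* :1 :+ s :* (b :* :0) := b) refl a b s)
        ; distrib =
            (λ (a , b) (c , d) (e , f) →
              solve 7 (λ a b c d e f t → a :* (c :+ e) :- t :* (b :* (d :+ f)) :=
                (a :* c :- t :* (b :* d)) :+ (a :* e :- t :* (b :* f))) refl a b c d e f t ,
              solve 7 (λ a b c d e f s → a :* (d :+ f) :+ b :* (c :+ e) :+ s :* (b :* (d :+ f)) :=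
                (a :* d :+ b :* c :+ s :* (b :* d)) :+ (a :* f :+ b :* e :+ s :* (b :* f))) refl a b c d e f s) ,
            (λ (a , b) (c , d) (e , f) →
              solve 7 (λ a b c d e f t → (c :+ e) :* a :- t :* ((d :+ f) :* b) :=
                (c :* a :- t :* (d :* b)) :+ (e :* a :- t :* (f :* b))) refl a b c d e f t ,
              solve 7 (λ a b c d e f s → (c :+ e) :* b :+ (d :+ f) :* a :+ s :* ((d :+ f) :* b) :=
                (c :* b :+ d :* a :+ s :* (d :* b)) :+ (e :* b :+ f :* a :+ s :* (f :* b))) refl a b c d e f s)
        }
      ; *-comm = λ (a , b) (c , d) →
          solve 5 (λ a b c d t → a :* c :- t :* (b :* d) := c :* a :- t :* (d :* b)) refl a b c d t ,
          solve 5 (λ a b c d s → a :* d :+ b :* c :+ s :* (b :* d) := c :* b :+ d :* a :+ s :* (d :* b)) refl a b c d s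
      }
    }

-- Coefficient lists form a polynomial ring with evaluation homomorphisms.

module PolynomialRing {c ℓ} (R : CommutativeRing c ℓ) where
  open CommutativeRing R hiding (zero; Carrier; ring)
  open import Data.List using ([]; _∷_)
  open Over R hiding (A)
  open RingSolver R

  -- Lists differing by trailing zeros are equal polynomials. As functions on ℕ, with value 0 past
  -- the end, they can be compared without regard to length.
  coefficient : Poly → ℕ → Carrier R
  coefficient []      n       = 0#
  coefficient (a ∷ p) zero    = a
  coefficient (a ∷ p) (suc n) = coefficient p n

  ≈P⇒coefficients : ∀ p q → p ≈P q → ∀ n → coefficient p n ≈ coefficient q n
  ≈P⇒coefficients []      []      _         n       = refl
  ≈P⇒coefficients []      (b ∷ q) (e , es) zero    = e
  ≈P⇒coefficients []      (b ∷ q) (e , es) (suc n) = ≈P⇒coefficients [] q es n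
  ≈P⇒coefficients (a ∷ p) []      (e , es) zero    = e
  ≈P⇒coefficients (a ∷ p) []      (e , es) (suc n) = ≈P⇒coefficients p [] es n
  ≈P⇒coefficients (a ∷ p) (b ∷ q) (e , es) zero    = e
  ≈P⇒coefficients (a ∷ p) (b ∷ q) (e , es) (suc n) = ≈P⇒coefficients p q es n

  coefficients⇒≈P : ∀ p q → (∀ n → coefficient p n ≈ coefficient q n) → p ≈P q
  coefficients⇒≈P []      []      e = tt
  coefficients⇒≈P []      (b ∷ q) e = e zero , coefficients⇒≈P [] q (e ∘ suc)
  coefficients⇒≈P (a ∷ p) []      e = e zero , coefficients⇒≈P p [] (e ∘ suc)
  coefficients⇒≈P (a ∷ p) (b ∷ q) e = e zero , coefficients⇒≈P p q (e ∘ suc)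

  -- A record, so that both sides can be inferred from a proof of equality.
  infix 4 _≃_
  record _≃_ (p q : Poly) : Set ℓ where
    constructor coefficientwise
    field at : ∀ n → coefficient p n ≈ coefficient q n
  open _≃_ public

  ≈P⇒≃ : ∀ {p q} → p ≈P q → p ≃ q
  ≈P⇒≃ {p} {q} e = coefficientwise (≈P⇒coefficients p q e)

  ≃⇒≈P : ∀ {p q} → p ≃ q → p ≈P q
  ≃⇒≈P {p} {q} e = coefficients⇒≈P p q (at e)

  coefficient-+ : ∀ p q n → coefficient (p +P q) n ≈ coefficient p n + coefficient q n
  coefficient-+ []      q       n       = sym (+-identityˡ _)
  coefficient-+ (a ∷ p) []      n       = sym (+-identityʳ _)
  coefficient-+ (a ∷ p) (b ∷ q) zero    = refl
  coefficient-+ (a ∷ p) (b ∷ q) (suc n) = coefficient-+ p q n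

  coefficient-· : ∀ a p n → coefficient (a ·P p) n ≈ a * coefficient p n
  coefficient-· a []      n       = sym (zeroʳ a)
  coefficient-· a (b ∷ p) zero    = refl
  coefficient-· a (b ∷ p) (suc n) = coefficient-· a p n

  coefficient-∷-cong : ∀ {a b} {p q} → a ≈ b → (∀ n → coefficient p n ≈ coefficient q n) →
    ∀ n → coefficient (a ∷ p) n ≈ coefficient (b ∷ q) n
  coefficient-∷-cong a≈b e zero    = a≈b
  coefficient-∷-cong a≈b e (suc n) = e n

  coefficient-*-zero : ∀ a p q → coefficient ((a ∷ p) *P q) zero ≈ a * coefficient q zero
  coefficient-*-zero a p q = trans (coefficient-+ (a ·P q) (0# ∷ (p *P q)) zero)
    (trans (+-identityʳ _) (coefficient-· a q zero))

  coefficient-*-suc : ∀ a p q n →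
    coefficient ((a ∷ p) *P q) (suc n) ≈ a * coefficient q (suc n) + coefficient (p *P q) n
  coefficient-*-suc a p q n = trans (coefficient-+ (a ·P q) (0# ∷ (p *P q)) (suc n))
    (+-congʳ (coefficient-· a q (suc n)))

  -- `_*P_` recurses on its left factor; this is the matching recursion on the right factor, from
  -- which commutativity follows.
  coefficient-*-∷ : ∀ p b q n →
    coefficient (p *P (b ∷ q)) n ≈ coefficient ((b ·P p) +P (0# ∷ (p *P q))) n
  coefficient-*-∷ [] b q zero    = refl
  coefficient-*-∷ [] b q (suc n) = refl
  coefficient-*-∷ (a ∷ p) b q zero = trans (coefficient-*-zero a p (b ∷ q)) (solve 2 (λ a b → a :* b := b :* a :+ :0) refl a b)
  coefficient-*-∷ (a ∷ p) b q (suc n) =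
    trans (trans (coefficient-*-suc a p (b ∷ q) n)
      (+-congˡ (trans (coefficient-*-∷ p b q n) (trans (coefficient-+ (b ·P p) _ n) (+-congʳ (coefficient-· b p n))))))
    (trans (solve 3 (λ x y z → x :+ (y :+ z) := y :+ (x :+ z)) refl _ _ _)
    (sym (trans (coefficient-+ (b ·P p) ((a ∷ p) *P q) n)
      (+-cong (coefficient-· b p n) (trans (coefficient-+ (a ·P q) (0# ∷ (p *P q)) n) (+-congʳ (coefficient-· a q n)))))))

  coefficient-*-[] : ∀ p n → coefficient (p *P []) n ≈ 0#
  coefficient-*-[] []      n       = refl
  coefficient-*-[] (a ∷ p) zero    = refl
  coefficient-*-[] (a ∷ p) (suc n) = coefficient-*-[] p n

  coefficient-*-comm : ∀ p q n → coefficient (p *P q) n ≈ coefficient (q *P p) n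
  coefficient-*-comm []      q n = sym (coefficient-*-[] q n)
  coefficient-*-comm (a ∷ p) q n =
    trans (coefficient-+ (a ·P q) (0# ∷ (p *P q)) n)
    (trans (+-congˡ (coefficient-∷-cong refl (coefficient-*-comm p q) n))
    (sym (trans (coefficient-*-∷ q a p n) (coefficient-+ (a ·P q) (0# ∷ (q *P p)) n))))

  coefficient-*-congʳ : ∀ p q q′ → (∀ n → coefficient q n ≈ coefficient q′ n) →
    ∀ n → coefficient (p *P q) n ≈ coefficient (p *P q′) n
  coefficient-*-congʳ []      q q′ e n       = refl
  coefficient-*-congʳ (a ∷ p) q q′ e zero    =
    trans (coefficient-*-zero a p q) (trans (*-congˡ (e zero)) (sym (coefficient-*-zero a p q′)))
  coefficient-*-congʳ (a ∷ p) q q′ e (suc n) = trans (coefficient-*-suc a p q n)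
    (trans (+-cong (*-congˡ (e (suc n))) (coefficient-*-congʳ p q q′ e n)) (sym (coefficient-*-suc a p q′ n)))

  coefficient-*-distribʳ : ∀ r p q n →
    coefficient ((p +P q) *P r) n ≈ coefficient ((p *P r) +P (q *P r)) n
  coefficient-*-distribʳ r []      q       n = refl
  coefficient-*-distribʳ r (a ∷ p) []      n =
    sym (trans (coefficient-+ ((a ∷ p) *P r) [] n) (+-identityʳ _))
  coefficient-*-distribʳ r (a ∷ p) (b ∷ q) zero = trans (coefficient-*-zero (a + b) (p +P q) r)
    (trans (distribʳ _ a b) (sym (trans (coefficient-+ ((a ∷ p) *P r) ((b ∷ q) *P r) zero)
      (+-cong (coefficient-*-zero a p r) (coefficient-*-zero b q r)))))
  coefficient-*-distribʳ r (a ∷ p) (b ∷ q) (suc n) = trans (coefficient-*-suc (a + b) (p +P q) r n)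
    (trans (+-congˡ (trans (coefficient-*-distribʳ r p q n) (coefficient-+ (p *P r) (q *P r) n)))
    (trans (solve 5 (λ a b x y z → (a :+ b) :* x :+ (y :+ z) := (a :* x :+ y) :+ (b :* x :+ z)) refl a b _ _ _)
    (sym (trans (coefficient-+ ((a ∷ p) *P r) ((b ∷ q) *P r) (suc n))
      (+-cong (coefficient-*-suc a p r n) (coefficient-*-suc b q r n))))))

  coefficient-·-* : ∀ a q r n → coefficient ((a ·P q) *P r) n ≈ a * coefficient (q *P r) n
  coefficient-·-* a []      r n       = sym (zeroʳ a)
  coefficient-·-* a (b ∷ q) r zero    = trans (coefficient-*-zero (a * b) (a ·P q) r)
    (trans (*-assoc _ _ _) (*-congˡ (sym (coefficient-*-zero b q r))))
  coefficient-·-* a (b ∷ q) r (suc n) = trans (coefficient-*-suc (a * b) (a ·P q) r n)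
    (trans (+-congˡ (coefficient-·-* a q r n))
    (trans (solve 4 (λ a b x y → a :* b :* x :+ a :* y := a :* (b :* x :+ y)) refl a b _ _)
    (*-congˡ (sym (coefficient-*-suc b q r n)))))

  coefficient-*-assoc : ∀ p q r n → coefficient ((p *P q) *P r) n ≈ coefficient (p *P (q *P r)) n
  coefficient-*-assoc []      q r n = refl
  coefficient-*-assoc (a ∷ p) q r n = trans
    (trans (coefficient-*-distribʳ r (a ·P q) (0# ∷ (p *P q)) n) (coefficient-+ ((a ·P q) *P r) ((0# ∷ (p *P q)) *P r) n))
    (trans (+-cong (trans (coefficient-·-* a q r n) (sym (coefficient-· a (q *P r) n))) (shift n))
    (sym (coefficient-+ (a ·P (q *P r)) (0# ∷ (p *P (q *P r))) n)))
    where
    shift : ∀ n → coefficient ((0# ∷ (p *P q)) *P r) n ≈ coefficient (0# ∷ (p *P (q *P r))) n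
    shift zero    = trans (coefficient-*-zero 0# (p *P q) r) (zeroˡ _)
    shift (suc n) = trans (coefficient-*-suc 0# (p *P q) r n)
      (trans (+-congʳ (zeroˡ _)) (trans (+-identityˡ _) (coefficient-*-assoc p q r n)))

  coefficient-- : ∀ p n → coefficient (-P p) n ≈ - coefficient p n
  coefficient-- p n = trans (coefficient-· (- 1#) p n) (solve 1 (λ x → :- :1 :* x := :- x) refl _)

  coefficient-1* : ∀ p n → coefficient (1P *P p) n ≈ coefficient p n
  coefficient-1* p zero    = trans (coefficient-*-zero 1# [] p) (*-identityˡ _)
  coefficient-1* p (suc n) = trans (coefficient-*-suc 1# [] p n) (trans (+-identityʳ _) (*-identityˡ _))

  private
    *-comm′ : ∀ p q → p *P q ≃ q *P p
    *-comm′ p q = coefficientwise (coefficient-*-comm p q)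

    +-comm′ : ∀ p q → p +P q ≃ q +P p
    +-comm′ p q = coefficientwise λ n →
      trans (coefficient-+ p q n) (trans (+-comm _ _) (sym (coefficient-+ q p n)))

    +-identityʳ′ : ∀ p n → coefficient (p +P 0P) n ≈ coefficient p n
    +-identityʳ′ p n = trans (coefficient-+ p 0P n) (+-identityʳ _)

    *-identityʳ′ : ∀ p n → coefficient (p *P 1P) n ≈ coefficient p n
    *-identityʳ′ p n = trans (coefficient-*-comm p 1P n) (coefficient-1* p n)

    distribˡ′ : ∀ r p q n → coefficient (r *P (p +P q)) n ≈ coefficient ((r *P p) +P (r *P q)) n
    distribˡ′ r p q n = trans (coefficient-*-comm r (p +P q) n) (trans (coefficient-*-distribʳ r p q n)
      (trans (coefficient-+ (p *P r) (q *P r) n)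
      (trans (+-cong (coefficient-*-comm p r n) (coefficient-*-comm q r n))
      (sym (coefficient-+ (r *P p) (r *P q) n)))))

    inverseʳ′ : ∀ p n → coefficient (p +P (-P p)) n ≈ 0#
    inverseʳ′ p n = trans (coefficient-+ p (-P p) n) (trans (+-congˡ (coefficient-- p n)) (-‿inverseʳ _))

  polynomialRing : CommutativeRing c ℓ
  polynomialRing = record
    { Carrier = Poly
    ; _≈_ = _≃_
    ; _+_ = _+P_
    ; _*_ = _*P_
    ; -_  = -P_
    ; 0#  = 0P
    ; 1#  = 1P
    ; isCommutativeRing = record
      { isRing = record
        { +-isAbelianGroup = record
          { isGroup = record
            { isMonoid = record
              { isSemigroup = record
                { isMagma = record
                  { isEquivalence = record
                    { refl  = coefficientwise (λ n → refl)
                    ; sym   = λ e → coefficientwise (λ n → sym (at e n))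
                    ; trans = λ e f → coefficientwise (λ n → trans (at e n) (at f n))
                    }
                  ; ∙-cong = λ {p} {p′} {q} {q′} e f → coefficientwise λ n →
                      trans (coefficient-+ p q n) (trans (+-cong (at e n) (at f n)) (sym (coefficient-+ p′ q′ n)))
                  }
                ; assoc = λ p q r → coefficientwise λ n →
                    trans (coefficient-+ (p +P q) r n) (trans (+-congʳ (coefficient-+ p q n)) (trans (+-assoc _ _ _)
                      (sym (trans (coefficient-+ p (q +P r) n) (+-congˡ (coefficient-+ q r n))))))
                }
              ; identity = (λ p → coefficientwise (λ n → refl)) , (λ p → coefficientwise (+-identityʳ′ p))
              }
            ; inverse =
                (λ p → coefficientwise λ n → trans (coefficient-+ (-P p) p n) (trans (+-comm _ _) (trans (sym (coefficient-+ p (-P p) n)) (inverseʳ′ p n)))) ,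
                (λ p → coefficientwise (inverseʳ′ p))
            ; ⁻¹-cong = λ {p} {q} e → coefficientwise λ n →
                trans (coefficient-- p n) (trans (-‿cong (at e n)) (sym (coefficient-- q n)))
            }
          ; comm = +-comm′
          }
        -- Congruence is proved directly in the right factor only; the left factor is reached
        -- through commutativity.
        ; *-cong = λ {p} {p′} {q} {q′} e f → coefficientwise λ n →
            trans (coefficient-*-congʳ p q q′ (at f) n)
            (trans (coefficient-*-comm p q′ n)
            (trans (coefficient-*-congʳ q′ p p′ (at e) n)
            (coefficient-*-comm q′ p′ n)))
        ; *-assoc = λ p q r → coefficientwise (coefficient-*-assoc p q r)
        ; *-identity = (λ p → coefficientwise (coefficient-1* p)) , (λ p → coefficientwise (*-identityʳ′ p))
        ; distrib = (λ r p q → coefficientwise (distribˡ′ r p q)) ,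
                    (λ r p q → coefficientwise (coefficient-*-distribʳ r p q))
        }
      ; *-comm = *-comm′
      }
    }

  constantHom : Hom R polynomialRing
  constantHom = record
    { ⟦_⟧   = constP
    ; isHom = record
      { isSemiringHomomorphism = record
        { isNearSemiringHomomorphism = record
          { +-isMonoidHomomorphism = record
            { isMagmaHomomorphism = record
              { isRelHomomorphism = record { cong = λ {x} {y} x≈y → ≈P⇒≃ {constP x} {constP y} (x≈y , tt) }
              ; homo = λ x y → ≈P⇒≃ {constP (x + y)} {constP (x + y)} (refl , tt)
              }
            ; ε-homo = ≈P⇒≃ {constP 0#} {0P} (refl , tt)
            }
          ; *-homo = λ x y → ≈P⇒≃ {constP (x * y)} {constP x *P constP y} (sym (+-identityʳ _) , tt)
          }
        ; 1#-homo = ≈P⇒≃ {1P} {1P} (refl , tt)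
        }
      ; -‿homo = λ x → ≈P⇒≃ {constP (- x)} { -P constP x} (solve 1 (λ x → :- x := :- :1 :* x) refl x , tt)
      }
    }

  module Evaluation {S : CommutativeRing c ℓ} (f : Hom R S) (a : Carrier S) where
    private
      module S = CommutativeRing S
      module f = Hom f
      module SS = RingSolver S

    evaluate : Poly → Carrier S
    evaluate []      = S.0#
    evaluate (b ∷ p) = f.⟦ b ⟧ S.+ a S.* evaluate p

    evaluate-zero : ∀ p → 0P ≈P p → S.0# S.≈ evaluate p
    evaluate-zero []      _       = S.refl
    evaluate-zero (b ∷ p) (e , es) = S.trans (SS.solve 1 (λ a → SS.:0 SS.:= SS.:0 SS.:+ a SS.:* SS.:0) S.refl a)
      (S.+-cong (S.trans (S.sym f.0#-homo) (f.⟦⟧-cong e)) (S.*-congˡ (evaluate-zero p es)))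

    evaluate-cong : ∀ p q → p ≈P q → evaluate p S.≈ evaluate q
    evaluate-cong []      q       e        = evaluate-zero q e
    evaluate-cong (b ∷ p) []      e        = S.sym (evaluate-zero (b ∷ p) (≃⇒≈P (CommutativeRing.sym polynomialRing (≈P⇒≃ {b ∷ p} {0P} e))))
    evaluate-cong (b ∷ p) (d ∷ q) (e , es) = S.+-cong (f.⟦⟧-cong e) (S.*-congˡ (evaluate-cong p q es))

    evaluate-+ : ∀ p q → evaluate (p +P q) S.≈ evaluate p S.+ evaluate q
    evaluate-+ []      q       = S.sym (S.+-identityˡ _)
    evaluate-+ (b ∷ p) []      = S.sym (S.+-identityʳ _)
    evaluate-+ (b ∷ p) (d ∷ q) = S.trans (S.+-cong (f.+-homo b d) (S.*-congˡ (evaluate-+ p q)))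
      (SS.solve 5 (λ b d a x y → (b SS.:+ d) SS.:+ a SS.:* (x SS.:+ y) SS.:= (b SS.:+ a SS.:* x) SS.:+ (d SS.:+ a SS.:* y)) S.refl _ _ _ _ _)

    evaluate-· : ∀ b p → evaluate (b ·P p) S.≈ f.⟦ b ⟧ S.* evaluate p
    evaluate-· b []      = S.sym (S.zeroʳ _)
    evaluate-· b (d ∷ p) = S.trans (S.+-cong (f.*-homo b d) (S.*-congˡ (evaluate-· b p)))
      (SS.solve 4 (λ b d a x → b SS.:* d SS.:+ a SS.:* (b SS.:* x) SS.:= b SS.:* (d SS.:+ a SS.:* x)) S.refl _ _ _ _)

    evaluate-* : ∀ p q → evaluate (p *P q) S.≈ evaluate p S.* evaluate q
    evaluate-* []      q = S.sym (S.zeroˡ _)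
    evaluate-* (b ∷ p) q = S.trans (evaluate-+ (b ·P q) (0# ∷ (p *P q)))
      (S.trans (S.+-cong (evaluate-· b q) (S.+-cong f.0#-homo (S.*-congˡ (evaluate-* p q))))
      (SS.solve 4 (λ b q a p → b SS.:* q SS.:+ (SS.:0 SS.:+ a SS.:* (p SS.:* q)) SS.:= (b SS.:+ a SS.:* p) SS.:* q) S.refl _ _ _ _))

    evaluate-constant : ∀ b → evaluate (constP b) S.≈ f.⟦ b ⟧
    evaluate-constant b = S.trans (S.+-congˡ (S.zeroʳ a)) (S.+-identityʳ _)

    evaluate-X : evaluate X S.≈ a
    evaluate-X = S.trans (S.+-cong f.0#-homo (S.*-congˡ (S.trans (evaluate-constant 1#) f.1#-homo)))
      (S.trans (S.+-identityˡ _) (S.*-identityʳ a))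

    evaluation : Hom polynomialRing S
    evaluation = record
      { ⟦_⟧   = evaluate
      ; isHom = record
        { isSemiringHomomorphism = record
          { isNearSemiringHomomorphism = record
            { +-isMonoidHomomorphism = record
              { isMagmaHomomorphism = record
                { isRelHomomorphism = record { cong = λ {p} {q} e → evaluate-cong p q (≃⇒≈P e) }
                ; homo = evaluate-+
                }
              ; ε-homo = S.refl
              }
            ; *-homo = evaluate-*
            }
          ; 1#-homo = S.trans (evaluate-constant 1#) f.1#-homo
          }
        ; -‿homo = λ p → S.trans (evaluate-· (- 1#) p)
            (S.trans (S.*-congʳ (S.trans (f.-‿homo 1#) (S.-‿cong f.1#-homo)))
            (SS.solve 1 (λ x → SS.:- SS.:1 SS.:* x SS.:= SS.:- x) S.refl _))
        }
      }

  coefficient-X* : ∀ p n → coefficient (X *P p) n ≈ coefficient (0# ∷ p) n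
  coefficient-X* p zero    = trans (coefficient-*-zero 0# 1P p) (zeroˡ _)
  coefficient-X* p (suc n) = trans (coefficient-*-suc 0# 1P p n)
    (trans (+-cong (zeroˡ _) (coefficient-1* p n)) (+-identityˡ _))

  module _ {u : Carrier R} (u-regular : Regular R u) where
    open Evaluation constantHom (constP u *P X)

    coefficient-uX* : ∀ p n → coefficient ((constP u *P X) *P p) n ≈ u * coefficient (0# ∷ p) n
    coefficient-uX* p n = trans (coefficient-*-assoc (constP u) X p n)
      (trans (coefficient-+ (u ·P (X *P p)) (0# ∷ []) n)
      (trans (+-cong (trans (coefficient-· u (X *P p) n) (*-congˡ (coefficient-X* p n))) (zero-tail n)) (+-identityʳ _)))
      where
      zero-tail : ∀ n → coefficient (0# ∷ []) n ≈ 0#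
      zero-tail zero    = refl
      zero-tail (suc n) = refl

    -- For p = b + X p′ the image is b + u X p′(u X): its constant coefficient is b, and the higher
    -- ones are u times the coefficients of p′(u X). Cancelling u leaves the claim for p′.
    evaluate-injective : ∀ p → (∀ n → coefficient (evaluate p) n ≈ 0#) → ∀ n → coefficient p n ≈ 0#
    evaluate-injective []      e n       = refl
    evaluate-injective (b ∷ p) e zero    = trans
      (solve 2 (λ b u → b := b :+ u :* :0) refl b u)
      (trans (+-congˡ (sym (coefficient-uX* (evaluate p) zero)))
      (trans (sym (coefficient-+ (constP b) ((constP u *P X) *P evaluate p) zero)) (e zero)))
    evaluate-injective (b ∷ p) e (suc n) = evaluate-injective p (λ m → u-regular _ (trans
      (sym (trans (+-identityˡ _) (coefficient-uX* (evaluate p) (suc m))))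
      (trans (sym (coefficient-+ (constP b) ((constP u *P X) *P evaluate p) (suc m))) (e (suc m))))) n

  polynomialExtension : PolynomialExtension R
  polynomialExtension = record
    { ring     = polynomialRing
    ; constant = constantHom
    ; X        = X
    ; eval     = λ f a → Evaluation.evaluation f a
    ; eval-constant = λ f a → Evaluation.evaluate-constant f a
    ; eval-X   = λ f a → Evaluation.evaluate-X f a
    -- Multiplication by `X` moves the coefficient of degree n to degree n + 1.
    ; X-regular = λ p e → coefficientwise λ n →
        trans (sym (coefficient-X* p (suc n))) (at e (suc n))
    ; scale-injective = λ u-regular p e → coefficientwise 
        (evaluate-injective u-regular p (at e))
    }

-- Scaling of products and determinants, and cancellation of powers.

module Products {c ℓ} (R : CommutativeRing c ℓ) where
  open CommutativeRing R hiding (zero; Carrier)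
  open RingSolver R
  open Determinant R
  open Multiplicativity R
  open BlockMatrices R
  open import Relation.Binary.Reasoning.Setoid setoid
  open import Algebra.Properties.Ring ring using (x∙y⁻¹≈ε⇒x≈y)
  open import Algebra.Properties.CommutativeMonoid.Sum *-commutativeMonoid public
    using () renaming (sum to ∏; sum-cong-≋ to ∏-cong; ∑-distrib-+ to ∏-distrib-*)

  ∏-scale : ∀ n a (t : Vector (Carrier R) n) → ∏ (λ i → a * t i) ≈ a ^ n * ∏ t
  ∏-scale zero    a t = sym (*-identityˡ 1#)
  ∏-scale (suc n) a t = trans (*-congˡ (∏-scale n a (tail t)))
    (solve 4 (λ a x p q → a :* x :* (p :* q) := a :* p :* (x :* q)) refl a _ _ _)

  det-scale : ∀ {n} a (M : Fin n → Vector (Carrier R) n) → det (λ i j → a * M i j) ≈ a ^ n * det M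
  det-scale {n} a M = begin
    det (λ i j → a * M i j)
      ≈⟨ det-cong (λ i j → sym (trans (sum-cong-≋ {n} (λ k → *-assoc a (δ i k) (M k j)))
           (trans (sym (*-distribˡ-sum {n} a (λ k → δ i k * M k j))) (*-congˡ (sum-δ i (λ k → M k j)))))) ⟩
    det ((λ i j → a * δ i j) ⊡ M)
      ≈⟨ det-⊡ _ _ ⟩
    det {n} (λ i j → a * δ i j) * det M
      ≈⟨ *-congʳ (det-scalar n a) ⟩
    a ^ n * det M ∎

  ^-cancel : ∀ {u} → Regular R u → ∀ n {x y} → u ^ n * x ≈ u ^ n * y → x ≈ y
  ^-cancel u-regular zero    e = trans (sym (*-identityˡ _)) (trans e (*-identityˡ _))
  ^-cancel {u} u-regular (suc n) {x} {y} e = ^-cancel u-regular n (x∙y⁻¹≈ε⇒x≈y _ _ (u-regular _ (begin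
    u * (u ^ n * x - u ^ n * y)       ≈⟨ solve 4 (λ u p x y → u :* (p :* x :- p :* y) := u :* p :* x :- u :* p :* y) refl u (u ^ n) x y ⟩
    u * u ^ n * x - u * u ^ n * y     ≈⟨ +-congʳ e ⟩
    u * u ^ n * y - u * u ^ n * y     ≈⟨ -‿inverseʳ _ ⟩
    0# ∎)))

-- Ring homomorphisms commute with sums, products and determinants.

module Homomorphism {c ℓ} {R S : CommutativeRing c ℓ} (f : Hom R S) where
  private
    module R = CommutativeRing R
    module S = CommutativeRing S
    module DR where
      open Determinant R public
      open Multiplicativity R public
      open Products R public
    module DS where
      open Determinant S public
      open Multiplicativity S public
      open Products S public
  open CommutativeRing S using (_≈_; refl; sym; trans; setoid)
  open Hom f renaming (⟦_⟧ to φ)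

  δ-homo : ∀ {n} (i j : Fin n) → φ (DR.δ i j) ≈ DS.δ i j
  δ-homo i j with does (i Fin.≟ j)
  ... | true  = 1#-homo
  ... | false = 0#-homo

  sum-homo : ∀ n (t : Vector (Carrier R) n) → φ (DR.sum t) ≈ DS.sum (λ i → φ (t i))
  sum-homo zero    t = 0#-homo
  sum-homo (suc n) t = trans (+-homo _ _) (S.+-congˡ (sum-homo n (tail t)))

  ∏-homo : ∀ n (t : Vector (Carrier R) n) → φ (DR.∏ t) ≈ DS.∏ (λ i → φ (t i))
  ∏-homo zero    t = 1#-homo
  ∏-homo (suc n) t = trans (*-homo _ _) (S.*-congˡ (∏-homo n (tail t)))

  ⊡-homo : ∀ {m n k} (M : Fin m → Vector (Carrier R) n) (N : Fin n → Vector (Carrier R) k) i j →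
    φ ((M DR.⊡ N) i j) ≈ ((λ i j → φ (M i j)) DS.⊡ (λ i j → φ (N i j))) i j
  ⊡-homo {n = n} M N i j = trans (sum-homo n (λ k → M i k R.* N k j)) (DS.sum-cong-≋ {n} (λ k → *-homo _ _))

  altSum-homo : ∀ n (t : Vector (Carrier R) n) → φ (DR.altSum t) ≈ DS.altSum (λ i → φ (t i))
  altSum-homo zero    t = trans (⟦⟧-cong (DR.altSum-zero (λ ()))) (trans 0#-homo (sym (DS.altSum-zero (λ ()))))
  altSum-homo (suc n) t = trans (⟦⟧-cong (DR.altSum-suc t)) (trans (+-homo _ _)
    (trans (S.+-congˡ (trans (-‿homo _) (S.-‿cong (altSum-homo n (tail t))))) (sym (DS.altSum-suc _))))

  det-homo : ∀ {n} (M : Fin n → Vector (Carrier R) n) → φ (DR.det M) ≈ DS.det (λ i j → φ (M i j))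
  det-homo {zero}  M = trans (⟦⟧-cong (DR.det-zero M)) (trans 1#-homo (sym (DS.det-zero _)))
  det-homo {suc n} M = trans (⟦⟧-cong (DR.det-suc M)) (trans (altSum-homo (suc n) _)
    (trans (DS.altSum-cong (λ j → trans (*-homo _ _) (S.*-congˡ (det-homo (λ r s → M (suc r) (punchIn j s))))))
      (sym (DS.det-suc _))))

  -homo : ∀ x y → φ (x R.- y) ≈ φ x S.- φ y
  -homo x y = trans (+-homo x (R.- y)) (S.+-congˡ (-‿homo y))

infixr 9 _∘ₕ_
_∘ₕ_ : ∀ {c ℓ} {R S T : CommutativeRing c ℓ} → Hom S T → Hom R S → Hom R T
_∘ₕ_ {T = T} g f = record
  { ⟦_⟧ = ⟦ g ⟧ ∘ ⟦ f ⟧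
  ; isHom = ∘-isRingHomomorphism (CommutativeRing.trans T) (Hom.isHom f) (Hom.isHom g)
  }

idₕ : ∀ {c ℓ} {R : CommutativeRing c ℓ} → Hom R R
idₕ {R = R} = record { ⟦_⟧ = λ x → x ; isHom = id-isRingHomomorphism _ (CommutativeRing.refl R) }

-- From det (x - A) to the determinant of a quadratic polynomial in A.

module Spectrum {c ℓ} (K : CommutativeRing c ℓ) {n} (A : Fin n → Vector (Carrier K) n) (λs : Vector (Carrier K) n)
  (P : PolynomialExtension K) where

  private
    module P = PolynomialExtension P
    module PR where
      open CommutativeRing P.ring public
      open Determinant P.ring public
      open Products P.ring public

  Splits : Set ℓ
  Splits = PR.det (λ i j → P.X PR.* PR.δ i j PR.- ⟦ P.constant ⟧ (A i j)) PR.≈ PR.∏ (λ i → P.X PR.- ⟦ P.constant ⟧ (λs i))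

  -- Substituting u y for y in det (y - uA) = ∏ (y - uλ) gives uⁿ times the
  -- hypothesis, and the substitution is injective because u is regular.
  det-linear : Splits → ∀ {T : CommutativeRing c ℓ} (Y : PolynomialExtension T) (f : Hom K T) →
    let
      open CommutativeRing T
      open Determinant T
      open Products T
    in
    ∀ {u} → Regular T u → ∀ α →
    det (λ i j → α * δ i j - u * ⟦ f ⟧ (A i j)) ≈ ∏ (λ i → α - u * ⟦ f ⟧ (λs i))
  det-linear splits {T} Y f {u} u-regular α = T.trans (T.sym det-at-α) (T.trans (Hom.⟦⟧-cong at-α in-Y) ∏-at-α)
    where
    module T where
      open CommutativeRing T public
      open Determinant T public
      open Products T public
    module Y = PolynomialExtension Y
    open CommutativeRing Y.ring hiding (Carrier)
    open Determinant Y.ring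
    open BlockMatrices Y.ring using (_^_)
    open Products Y.ring
    open RingSolver Y.ring
    open import Relation.Binary.Reasoning.Setoid setoid
    open import Algebra.Properties.Ring (CommutativeRing.ring Y.ring) using (x∙y⁻¹≈ε⇒x≈y)

    U = ⟦ Y.constant ⟧ u

    h : Hom K Y.ring
    h = Y.constant ∘ₕ f

    a : Fin n → Vector (Carrier Y.ring) n
    a i j = ⟦ h ⟧ (A i j)

    l : Vector (Carrier Y.ring) n
    l i = ⟦ h ⟧ (λs i)

    toY : Hom P.ring Y.ring
    toY = P.eval h Y.X

    scale : Hom Y.ring Y.ring
    scale = Y.eval Y.constant (U * Y.X)

    at-α : Hom Y.ring T
    at-α = Y.eval idₕ α

    -- The hypothesis is an identity in K[X]; `toY` extends `f` and carries it to T[y].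
    splits-Y : det (λ i j → Y.X * δ i j - a i j) ≈ ∏ (λ i → Y.X - l i)
    splits-Y = begin
      det (λ i j → Y.X * δ i j - a i j)
        ≈⟨ det-cong (λ i j → sym (trans (H.-homo _ _) (+-cong (trans (Hom.*-homo toY _ _) (*-cong (P.eval-X h Y.X) (H.δ-homo i j)))
             (-‿cong (P.eval-constant h Y.X (A i j)))))) ⟩
      det (λ i j → ⟦ toY ⟧ (P.X PR.* PR.δ i j PR.- ⟦ P.constant ⟧ (A i j)))
        ≈⟨ H.det-homo (λ i j → P.X PR.* PR.δ i j PR.- ⟦ P.constant ⟧ (A i j)) ⟨
      ⟦ toY ⟧ (PR.det (λ i j → P.X PR.* PR.δ i j PR.- ⟦ P.constant ⟧ (A i j)))
        ≈⟨ Hom.⟦⟧-cong toY splits ⟩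
      ⟦ toY ⟧ (PR.∏ (λ i → P.X PR.- ⟦ P.constant ⟧ (λs i)))
        ≈⟨ H.∏-homo n (λ i → P.X PR.- ⟦ P.constant ⟧ (λs i)) ⟩
      ∏ (λ i → ⟦ toY ⟧ (P.X PR.- ⟦ P.constant ⟧ (λs i)))
        ≈⟨ ∏-cong {n} (λ i → trans (H.-homo _ _) (+-cong (P.eval-X h Y.X) (-‿cong (P.eval-constant h Y.X (λs i))))) ⟩
      ∏ (λ i → Y.X - l i) ∎
      where module H = Homomorphism toY

    d p : Carrier Y.ring
    d = det (λ i j → Y.X * δ i j - U * a i j)
    p = ∏ (λ i → Y.X - U * l i)

    module HS = Homomorphism scale

    scale-U : ∀ x → ⟦ scale ⟧ (U * ⟦ h ⟧ x) ≈ U * ⟦ h ⟧ x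
    scale-U x = trans (Hom.*-homo scale _ _) (*-cong (Y.eval-constant Y.constant _ u) (Y.eval-constant Y.constant _ (⟦ f ⟧ x)))

    -- Only the indeterminate is scaled while the constants U a are fixed, so afterwards both terms
    -- of each entry have the factor U.
    scale-d : ⟦ scale ⟧ d ≈ U ^ n * det (λ i j → Y.X * δ i j - a i j)
    scale-d = begin
      ⟦ scale ⟧ d
        ≈⟨ HS.det-homo _ ⟩
      det (λ i j → ⟦ scale ⟧ (Y.X * δ i j - U * a i j))
        ≈⟨ det-cong (λ i j → trans (HS.-homo _ _) (trans (+-cong (trans (Hom.*-homo scale _ _)
             (*-cong (Y.eval-X Y.constant _) (HS.δ-homo i j))) (-‿cong (scale-U (A i j))))
             (solve 4 (λ u x d a → u :* x :* d :- u :* a := u :* (x :* d :- a)) refl U Y.X (δ i j) (a i j)))) ⟩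
      det (λ i j → U * (Y.X * δ i j - a i j))
        ≈⟨ det-scale U _ ⟩
      U ^ n * det (λ i j → Y.X * δ i j - a i j) ∎

    scale-p : ⟦ scale ⟧ p ≈ U ^ n * ∏ (λ i → Y.X - l i)
    scale-p = begin
      ⟦ scale ⟧ p
        ≈⟨ HS.∏-homo n _ ⟩
      ∏ (λ i → ⟦ scale ⟧ (Y.X - U * l i))
        ≈⟨ ∏-cong {n} (λ i → trans (HS.-homo _ _) (trans (+-cong (Y.eval-X Y.constant _) (-‿cong (scale-U (λs i))))
             (solve 3 (λ u x l → u :* x :- u :* l := u :* (x :- l)) refl U Y.X (l i)))) ⟩
      ∏ (λ i → U * (Y.X - l i))
        ≈⟨ ∏-scale n U _ ⟩
      U ^ n * ∏ (λ i → Y.X - l i) ∎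

    in-Y : d ≈ p
    in-Y = x∙y⁻¹≈ε⇒x≈y d p (Y.scale-injective u-regular (d - p)
      (trans (HS.-homo d p) (trans (+-cong (trans scale-d (*-congˡ splits-Y)) (-‿cong scale-p)) (-‿inverseʳ _))))

    module HA = Homomorphism at-α

    at-α-U : ∀ x → ⟦ at-α ⟧ (U * ⟦ h ⟧ x) T.≈ u T.* ⟦ f ⟧ x
    at-α-U x = T.trans (Hom.*-homo at-α _ _) (T.*-cong (Y.eval-constant idₕ α u) (Y.eval-constant idₕ α (⟦ f ⟧ x)))

    det-at-α : ⟦ at-α ⟧ d T.≈ T.det (λ i j → α T.* T.δ i j T.- u T.* ⟦ f ⟧ (A i j))
    det-at-α = T.trans (HA.det-homo _) (T.det-cong (λ i j → T.trans (HA.-homo _ _)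
      (T.+-cong (T.trans (Hom.*-homo at-α _ _) (T.*-cong (Y.eval-X idₕ α) (HA.δ-homo i j))) (T.-‿cong (at-α-U (A i j))))))

    ∏-at-α : ⟦ at-α ⟧ p T.≈ T.∏ (λ i → α T.- u T.* ⟦ f ⟧ (λs i))
    ∏-at-α = T.trans (HA.∏-homo n _) (T.∏-cong {n} (λ i → T.trans (HA.-homo _ _)
      (T.+-cong (Y.eval-X idₕ α) (T.-‿cong (at-α-U (λs i))))))

  private
    module Quadratic (splits : Splits) {T : CommutativeRing c ℓ} (S : PolynomialExtension T) (f : Hom K T)
      (u v w : Carrier T) where
      module T where
        open CommutativeRing T public
        open Determinant T public
        open Multiplicativity T public
        open Products T public
      module S where
        open PolynomialExtension S public
        open CommutativeRing ring public hiding (ring)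
        open Determinant ring public
        open Multiplicativity ring public
        open Products ring public

      g : Hom K S.ring
      g = S.constant ∘ₕ f

      v′ w′ : Carrier S.ring
      v′ = ⟦ S.constant ⟧ v
      w′ = ⟦ S.constant ⟧ w

      a : Fin n → Vector (Carrier S.ring) n
      a i j = ⟦ g ⟧ (A i j)

      l : Vector (Carrier S.ring) n
      l i = ⟦ g ⟧ (λs i)

      M : Fin n → Vector (Carrier S.ring) n
      M i j = w′ S.* S.δ i j S.+ v′ S.* a i j S.+ S.X S.* (a S.⊡ a) i j

      p : Vector (Carrier S.ring) n
      p i = w′ S.+ v′ S.* l i S.+ S.X S.* (l i S.* l i)

      -- X (w + v x + X x²) = (X x - α)(X x - β) as soon as α + β = - v and α β = X w.
      module Factor (E : QuadraticExtension S.ring (S.- v′) (S.X S.* w′))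
        (Y : PolynomialExtension (QuadraticExtension.ring E)) where
        module E = QuadraticExtension E
        open E using (α; β)
        open CommutativeRing E.ring hiding (Carrier)
        open Determinant E.ring
        open Multiplicativity E.ring
        open BlockMatrices E.ring using (_^_; ⊡-identityʳ)
        open Products E.ring
        open RingSolver E.ring
        open Homomorphism E.inclusion
        open Hom E.inclusion using () renaming (⟦_⟧ to ι; +-homo to ι-+; *-homo to ι-*; -‿homo to ι--)
        open import Relation.Binary.Reasoning.Setoid setoid

        U V W : Carrier E.ring
        U = ι S.X
        V = ι v′
        W = ι w′

        b : Fin n → Vector (Carrier E.ring) n
        b i j = ι (a i j)

        m : Vector (Carrier E.ring) n
        m i = ι (l i)

        U-regular : Regular E.ring U
        U-regular = E.regular S.X-regular

        α+β : α + β ≈ - V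
        α+β = trans E.α+β (ι-- v′)

        αβ : α * β ≈ U * W
        αβ = trans E.α*β (ι-* S.X w′)

        factor : ∀ x → (α - U * x) * (β - U * x) ≈ U * (W + V * x + U * (x * x))
        factor x = begin
          (α - U * x) * (β - U * x)
            ≈⟨ solve 4 (λ α β u x → (α :- u :* x) :* (β :- u :* x) := α :* β :+ (:- (α :+ β)) :* (u :* x) :+ u :* u :* (x :* x)) refl α β U x ⟩
          α * β + (- (α + β)) * (U * x) + U * U * (x * x)
            ≈⟨ +-congʳ (+-cong αβ (*-congʳ (-‿cong α+β))) ⟩
          U * W + (- - V) * (U * x) + U * U * (x * x)
            ≈⟨ solve 4 (λ u v w x → u :* w :+ (:- :- v) :* (u :* x) :+ u :* u :* (x :* x) := u :* (w :+ v :* x :+ u :* (x :* x))) refl U V W x ⟩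
          U * (W + V * x + U * (x * x)) ∎

        B C : Fin n → Vector (Carrier E.ring) n
        B i j = α * δ i j - U * b i j
        C i j = β * δ i j - U * b i j

        factor-matrix : ∀ i j → (B ⊡ C) i j ≈ U * (W * δ i j + V * b i j + U * (b ⊡ b) i j)
        factor-matrix i k = begin
          -- The product is distributed just far enough that every sum either contains a `δ`, and so
          -- collapses, or is an entry of `b ⊡ b`. The two mixed terms recombine into the
          -- coefficient α + β afterwards.
          sum (λ j → (α * δ i j - U * b i j) * (β * δ j k - U * b j k))
            ≈⟨ sum-cong-≋ {n} (λ j → solve 7 (λ α β u d e x y → (α :* d :- u :* x) :* (β :* e :- u :* y) :=
                 α :* (d :* (β :* e :- u :* y)) :+ ((:- (β :* u)) :* (x :* e) :+ u :* u :* (x :* y))) refl α β U (δ i j) (δ j k) (b i j) (b j k)) ⟩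
          sum (λ j → α * (δ i j * (β * δ j k - U * b j k)) + (- (β * U) * (b i j * δ j k) + U * U * (b i j * b j k)))
            ≈⟨ trans (∑-distrib-+ {n} (λ j → α * (δ i j * (β * δ j k - U * b j k))) (λ j → - (β * U) * (b i j * δ j k) + U * U * (b i j * b j k)))
                 (+-congˡ (∑-distrib-+ {n} (λ j → - (β * U) * (b i j * δ j k)) (λ j → U * U * (b i j * b j k)))) ⟩
          sum (λ j → α * (δ i j * (β * δ j k - U * b j k))) + (sum (λ j → - (β * U) * (b i j * δ j k)) + sum (λ j → U * U * (b i j * b j k)))
            ≈⟨ +-cong (trans (sym (*-distribˡ-sum {n} α (λ j → δ i j * (β * δ j k - U * b j k)))) (*-congˡ (sum-δ i (λ j → β * δ j k - U * b j k))))
                 (+-cong (trans (sym (*-distribˡ-sum {n} (- (β * U)) (λ j → b i j * δ j k))) (*-congˡ (⊡-identityʳ b i k)))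
                   (sym (*-distribˡ-sum {n} (U * U) (λ j → b i j * b j k)))) ⟩
          α * (β * δ i k - U * b i k) + (- (β * U) * b i k + U * U * (b ⊡ b) i k)
            ≈⟨ solve 6 (λ α β u d x y → α :* (β :* d :- u :* x) :+ ((:- (β :* u)) :* x :+ u :* u :* y) :=
                 α :* β :* d :+ (:- (α :+ β)) :* (u :* x) :+ u :* u :* y) refl α β U (δ i k) (b i k) ((b ⊡ b) i k) ⟩
          α * β * δ i k + (- (α + β)) * (U * b i k) + U * U * (b ⊡ b) i k
            ≈⟨ +-congʳ (+-cong (*-congʳ αβ) (*-congʳ (-‿cong α+β))) ⟩
          U * W * δ i k + (- - V) * (U * b i k) + U * U * (b ⊡ b) i k
            ≈⟨ solve 6 (λ u v w d x y → u :* w :* d :+ (:- :- v) :* (u :* x) :+ u :* u :* y := u :* (w :* d :+ v :* x :+ u :* y)) refl U V W (δ i k) (b i k) ((b ⊡ b) i k) ⟩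
          U * (W * δ i k + V * b i k + U * (b ⊡ b) i k) ∎

        ι-M : ∀ i j → ι (M i j) ≈ W * δ i j + V * b i j + U * (b ⊡ b) i j
        ι-M i j = trans (ι-+ _ _) (+-cong (trans (ι-+ _ _) (+-cong (trans (ι-* _ _) (*-congˡ (δ-homo i j))) (ι-* _ _)))
          (trans (ι-* _ _) (*-congˡ (⊡-homo a a i j))))

        ι-p : ∀ i → ι (p i) ≈ W + V * m i + U * (m i * m i)
        ι-p i = trans (ι-+ _ _) (+-cong (trans (ι-+ _ _) (+-congˡ (ι-* _ _)))
          (trans (ι-* _ _) (*-congˡ (ι-* _ _))))

        det-M : S.det M S.≈ S.∏ p
        -- The identity holds in the extension after multiplication by `U ^ n`. Regularity of `U`
        -- removes that power, and injectivity of the inclusion brings the result back to T[X].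
        det-M = E.injective (^-cancel U-regular n (begin
          U ^ n * ι (S.det M)
            ≈⟨ *-congˡ (trans (det-homo M) (det-cong ι-M)) ⟩
          U ^ n * det (λ i j → W * δ i j + V * b i j + U * (b ⊡ b) i j)
            ≈⟨ det-scale U _ ⟨
          det (λ i j → U * (W * δ i j + V * b i j + U * (b ⊡ b) i j))
            ≈⟨ det-cong (λ i j → sym (factor-matrix i j)) ⟩
          det (B ⊡ C)
            ≈⟨ det-⊡ B C ⟩
          det B * det C
            ≈⟨ *-cong (det-linear splits Y (E.inclusion ∘ₕ g) U-regular α) (det-linear splits Y (E.inclusion ∘ₕ g) U-regular β) ⟩
          ∏ (λ i → α - U * m i) * ∏ (λ i → β - U * m i)
            ≈⟨ ∏-distrib-* {n} (λ i → α - U * m i) (λ i → β - U * m i) ⟨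
          ∏ (λ i → (α - U * m i) * (β - U * m i))
            ≈⟨ ∏-cong {n} (λ i → factor (m i)) ⟩
          ∏ (λ i → U * (W + V * m i + U * (m i * m i)))
            ≈⟨ ∏-scale n U _ ⟩
          U ^ n * ∏ (λ i → W + V * m i + U * (m i * m i))
            ≈⟨ *-congˡ (trans (∏-homo n p) (∏-cong {n} ι-p)) ⟨
          U ^ n * ι (S.∏ p) ∎))

      at-u : Hom S.ring T
      at-u = S.eval idₕ u

      module H where
        open Homomorphism at-u public
        open Hom at-u public

      specialise : S.det M S.≈ S.∏ p →
        T.det (λ i j → w T.* T.δ i j T.+ v T.* ⟦ f ⟧ (A i j) T.+ u T.* ((λ i j → ⟦ f ⟧ (A i j)) T.⊡ (λ i j → ⟦ f ⟧ (A i j))) i j) T.≈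
        T.∏ (λ i → w T.+ v T.* ⟦ f ⟧ (λs i) T.+ u T.* (⟦ f ⟧ (λs i) T.* ⟦ f ⟧ (λs i)))
      specialise e = T.trans (T.sym (T.trans (H.det-homo M) (T.det-cong at-u-M)))
        (T.trans (H.⟦⟧-cong e) (T.trans (H.∏-homo n p) (T.∏-cong {n} at-u-p)))
        where
        at-u-constant : ∀ t → ⟦ at-u ⟧ (⟦ S.constant ⟧ t) T.≈ t
        at-u-constant = S.eval-constant idₕ u

        at-u-M : ∀ i j → ⟦ at-u ⟧ (M i j) T.≈ w T.* T.δ i j T.+ v T.* ⟦ f ⟧ (A i j) T.+ u T.* ((λ i j → ⟦ f ⟧ (A i j)) T.⊡ (λ i j → ⟦ f ⟧ (A i j))) i j
        at-u-M i j = T.trans (H.+-homo _ _) (T.+-cong (T.trans (H.+-homo _ _) (T.+-cong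
            (T.trans (H.*-homo _ _) (T.*-cong (at-u-constant w) (H.δ-homo i j)))
            (T.trans (H.*-homo _ _) (T.*-cong (at-u-constant v) (at-u-constant (⟦ f ⟧ (A i j)))))))
          (T.trans (H.*-homo _ _) (T.*-cong (S.eval-X idₕ u) (T.trans (H.⊡-homo a a i j)
            (T.sum-cong-≋ {n} (λ k → T.*-cong (at-u-constant (⟦ f ⟧ (A i k))) (at-u-constant (⟦ f ⟧ (A k j)))))))))

        at-u-p : ∀ i → ⟦ at-u ⟧ (p i) T.≈ w T.+ v T.* ⟦ f ⟧ (λs i) T.+ u T.* (⟦ f ⟧ (λs i) T.* ⟦ f ⟧ (λs i))
        at-u-p i = T.trans (H.+-homo _ _) (T.+-cong (T.trans (H.+-homo _ _) (T.+-cong (at-u-constant w)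
            (T.trans (H.*-homo _ _) (T.*-cong (at-u-constant v) (at-u-constant (⟦ f ⟧ (λs i)))))))
          (T.trans (H.*-homo _ _) (T.*-cong (S.eval-X idₕ u) (T.trans (H.*-homo _ _)
            (T.*-cong (at-u-constant (⟦ f ⟧ (λs i))) (at-u-constant (⟦ f ⟧ (λs i))))))))

  -- Only here are concrete extension rings supplied; the argument above treats them as opaque.
  det-quadratic : Splits → ∀ {T : CommutativeRing c ℓ} (f : Hom K T) →
    let
      open CommutativeRing T
      open Determinant T
      open Multiplicativity T
      open Products T
      B = λ i j → ⟦ f ⟧ (A i j)
      μ = λ i → ⟦ f ⟧ (λs i)
    in
    ∀ u v w →
    det (λ i j → w * δ i j + v * B i j + u * (B ⊡ B) i j) ≈ ∏ (λ i → w + v * μ i + u * (μ i * μ i))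
  det-quadratic splits {T} f u v w = specialise (Factor.det-M
      (quadraticExtension S.ring (S.- v′) (S.X S.* w′)) (PolynomialRing.polynomialExtension _))
    where
    open Quadratic splits (PolynomialRing.polynomialExtension T) f u v w

-- The characteristic matrix of the neighbourhood corona in block form.

module CoronaDeterminant {c ℓ} (R : CommutativeRing c ℓ) (x : Carrier R) where
  open CommutativeRing R hiding (zero; Carrier)
  open RingSolver R
  open Determinant R
  open Multiplicativity R
  open BlockMatrices R
  open import Relation.Binary.Reasoning.Setoid setoid

  private
    variable
      m n : ℕ

  indicator : Bool → Carrier R
  indicator b = if b then 1# else 0#

  adjacency : Graph n → Fin n → Vector (Carrier R) n
  adjacency G i j = indicator (adj G i j)

  characteristic : Graph n → Fin n → Vector (Carrier R) n
  characteristic G i j = x * δ i j - adjacency G i j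

  -- Decidable equality on `Fin (m + n)` does not compute through `splitAt`, so the identity matrix
  -- has to be cut into blocks by recursion on m.
  δ-block : ∀ m i j → δ {m ℕ.+ n} i j ≈ block {m} δ 𝟎 𝟎 (δ {n}) i j
  δ-block zero    i j = refl
  δ-block (suc m) zero zero = refl
  δ-block (suc m) zero (suc j) with splitAt m j
  ... | inj₁ _ = refl
  ... | inj₂ _ = refl
  δ-block (suc m) (suc i) zero with splitAt m i
  ... | inj₁ _ = refl
  ... | inj₂ _ = refl
  δ-block (suc m) (suc i) (suc j) = trans (δ-block m i j) shift
    where
    shift : block {m} δ 𝟎 𝟎 δ i j ≈ block {suc m} δ 𝟎 𝟎 δ (suc i) (suc j)
    shift with splitAt m i | splitAt m j
    ... | inj₁ _ | inj₁ _ = refl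
    ... | inj₁ _ | inj₂ _ = refl
    ... | inj₂ _ | inj₁ _ = refl
    ... | inj₂ _ | inj₂ _ = refl

  δ-kronecker : ∀ m n i j → δ {m ℕ.* n} i j ≈ kronecker {m} {n} δ δ i j
  δ-kronecker (suc m) n i j = trans (δ-block n i j) entries
    where
    entries : block {n} δ 𝟎 𝟎 δ i j ≈ kronecker {suc m} {n} δ δ i j
    entries with splitAt n i | splitAt n j
    ... | inj₁ _ | inj₁ _ = sym (*-identityˡ _)
    ... | inj₁ _ | inj₂ _ = sym (zeroˡ _)
    ... | inj₂ _ | inj₁ _ = sym (zeroˡ _)
    ... | inj₂ i | inj₂ j = δ-kronecker m n i j

  sum-remQuot : ∀ m n (f : Fin m × Fin n → Carrier R) →
    sum (λ w → f (remQuot {m} n w)) ≈ sum (λ k → sum (λ u → f (k , u)))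
  sum-remQuot zero    n f = refl
  sum-remQuot (suc m) n f = begin
    sum (λ w → f (remQuot {suc m} n w))
      ≈⟨ sum-cong-≋ {n ℕ.+ m ℕ.* n} split ⟩
    sum (λ w → g (splitAt n w))
      ≈⟨ sum-block n (λ w → g (splitAt n w)) ⟩
    sum (λ u → g (splitAt n (u ↑ˡ (m ℕ.* n)))) + sum (λ w → g (splitAt n (n ↑ʳ w)))
      ≈⟨ +-cong (sum-cong-≋ {n} (λ u → reflexive (≡.cong g (splitAt-↑ˡ n u (m ℕ.* n)))))
                (sum-cong-≋ {m ℕ.* n} (λ w → reflexive (≡.cong g (splitAt-↑ʳ n (m ℕ.* n) w)))) ⟩
    sum (λ u → f (zero , u)) + sum (λ w → f (suc (proj₁ (remQuot {m} n w)) , proj₂ (remQuot {m} n w)))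
      ≈⟨ +-congˡ (sum-remQuot m n (λ p → f (suc (proj₁ p) , proj₂ p))) ⟩
    sum (λ u → f (zero , u)) + sum (λ k → sum (λ u → f (suc k , u))) ∎
    where
    g : Fin n ⊎ Fin (m ℕ.* n) → Carrier R
    g (inj₁ u) = f (zero , u)
    g (inj₂ w) = f (suc (proj₁ (remQuot {m} n w)) , proj₂ (remQuot {m} n w))

    split : ∀ w → f (remQuot {suc m} n w) ≈ g (splitAt n w)
    split w with splitAt n w
    ... | inj₁ _ = refl
    ... | inj₂ _ = refl

  module _ {n₁ n₂} (G₁ : Graph n₁) (G₂ : Graph n₂) where
    private
      k : Fin (n₁ ℕ.* n₂) → Fin n₁
      k w = proj₁ (remQuot {n₁} n₂ w)

      u : Fin (n₁ ℕ.* n₂) → Fin n₂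
      u w = proj₂ (remQuot {n₁} n₂ w)

      A = adjacency G₁
      N = characteristic G₂

      P : Fin n₁ → Vector (Carrier R) n₁
      P = characteristic G₁

      Q : Fin n₁ → Vector (Carrier R) (n₁ ℕ.* n₂)
      Q i w = - A (k w) i

      S : Fin (n₁ ℕ.* n₂) → Vector (Carrier R) n₁
      S w i = - A (k w) i

      T : Fin (n₁ ℕ.* n₂) → Vector (Carrier R) (n₁ ℕ.* n₂)
      T = kronecker {n₁} δ N

    characteristic-⋆ : ∀ i → characteristic (G₁ ⋆ G₂) i ≋ block P Q S T i
    characteristic-⋆ i j = trans (+-congʳ (*-congˡ (trans (δ-block n₁ i j)
        (block-cong {n₁} (λ i → ≋-refl) (λ i → ≋-refl) (λ i → ≋-refl) (δ-kronecker n₁ n₂) i j)))) entries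
      where
      entries : x * block {n₁} δ 𝟎 𝟎 (kronecker {n₁} δ δ) i j - adjacency (G₁ ⋆ G₂) i j ≈ block P Q S T i j
      entries with splitAt n₁ i | splitAt n₁ j
      ... | inj₁ i | inj₁ j = refl
      ... | inj₁ i | inj₂ w = trans (+-congʳ (zeroʳ x)) (+-identityˡ _)
      ... | inj₂ v | inj₁ j = trans (+-congʳ (zeroʳ x)) (+-identityˡ _)
      -- The same decision occurs in `δ` between the copies and in the adjacency of `_⋆_`; splitting
      -- on it settles both.
      ... | inj₂ v | inj₂ w with k v Fin.≟ k w
      ... | yes _ = solve 3 (λ x d a → x :* (:1 :* d) :- a := :1 :* (x :* d :- a)) refl x (δ (u v) (u w)) (indicator (adj G₂ (u v) (u w)))
      ... | no _  = solve 3 (λ x d n → x :* (:0 :* d) :- :0 := :0 :* n) refl x (δ (u v) (u w)) (N (u v) (u w))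

    -- Multiplying on the right by the block matrix (E , 0 ; A ⊗ B1 , 1) clears the lower left block.
    det-⋆ : ∀ (B : Fin n₂ → Vector (Carrier R) n₂) E → (∀ i j → (N ⊡ B) i j ≈ E * δ i j) →
      det (characteristic (G₁ ⋆ G₂)) * E ^ n₁ ≈
      det (λ i j → E * x * δ i j + - E * A i j + - sum (λ i → sum (λ j → B i j)) * (A ⊡ A) i j) * det N ^ n₁
    det-⋆ B E NB≈E = begin
      det (characteristic (G₁ ⋆ G₂)) * E ^ n₁
        ≈⟨ *-cong (det-cong characteristic-⋆) (sym det-L) ⟩
      det (block P Q S T) * det (block Eδ 𝟎 S′ δ)
        ≈⟨ det-⊡ _ _ ⟨
      det (block P Q S T ⊡ block Eδ 𝟎 S′ δ)
        ≈⟨ det-cong (λ i j → trans (block-⊡ P Eδ Q 𝟎 S S′ T δ i j)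
             (block-cong upperLeft (λ i → ≋-refl) lowerLeft lowerRight i j)) ⟩
      det (block P′ (P ⊡ 𝟎 ⊞ Q ⊡ δ) 𝟎 T)
        ≈⟨ det-block-upper P′ (P ⊡ 𝟎 ⊞ Q ⊡ δ) T ⟩
      det P′ * det T
        ≈⟨ *-congˡ (det-diagonal n₁ N) ⟩
      det P′ * det N ^ n₁ ∎
      where
      r : Vector (Carrier R) n₂
      r v = sum (λ j → B v j)

      C : Carrier R
      C = sum r

      Eδ P′ : Fin n₁ → Vector (Carrier R) n₁
      Eδ i j = E * δ i j
      P′ i j = E * x * δ i j + - E * A i j + - C * (A ⊡ A) i j

      S′ : Fin (n₁ ℕ.* n₂) → Vector (Carrier R) n₁
      S′ w j = A (k w) j * r (u w)

      det-L : det (block Eδ 𝟎 S′ δ) ≈ E ^ n₁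
      det-L = trans (det-block-lower Eδ S′ δ)
        (trans (*-cong (det-scalar n₁ E) (det-δ (n₁ ℕ.* n₂))) (*-identityʳ _))

      ⊡-Eδ : ∀ {m} (M : Fin m → Vector (Carrier R) n₁) i j → (M ⊡ Eδ) i j ≈ E * M i j
      ⊡-Eδ M i j = trans (sum-cong-≋ {n₁} (λ l → solve 3 (λ m e d → m :* (e :* d) := e :* (m :* d)) refl (M i l) E (δ l j)))
        (trans (sym (*-distribˡ-sum {n₁} E (λ l → M i l * δ l j))) (*-congˡ (⊡-identityʳ M i j)))

      -- Summing over a whole copy turns the vector `r` into the scalar C, so Q S′ is - C times AᵀA;
      -- this equals - C A² by the symmetry of `G₁`.
      upperLeft : ∀ i → (P ⊡ Eδ ⊞ Q ⊡ S′) i ≋ P′ i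
      upperLeft i j = begin
        (P ⊡ Eδ) i j + (Q ⊡ S′) i j
          ≈⟨ +-cong (⊡-Eδ P i j) (sum-remQuot n₁ n₂ (λ p → - A (proj₁ p) i * (A (proj₁ p) j * r (proj₂ p)))) ⟩
        E * P i j + sum (λ l → sum (λ v → - A l i * (A l j * r v)))
          ≈⟨ +-congˡ (sum-cong-≋ {n₁} (λ l → trans
               (sum-cong-≋ {n₂} (λ v → solve 3 (λ a b r → :- a :* (b :* r) := (:- (a :* b)) :* r) refl (A l i) (A l j) (r v)))
               (trans (sym (*-distribˡ-sum {n₂} (- (A l i * A l j)) r))
               (trans (solve 3 (λ a b c → (:- (a :* b)) :* c := (:- c) :* (a :* b)) refl (A l i) (A l j) C)
               (*-congˡ (*-congʳ (reflexive (≡.cong indicator (Graph.sym G₁ l i))))))))) ⟩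
        E * P i j + sum (λ l → - C * (A i l * A l j))
          ≈⟨ +-congˡ (*-distribˡ-sum {n₁} (- C) (λ l → A i l * A l j)) ⟨
        E * (x * δ i j - A i j) + - C * (A ⊡ A) i j
          ≈⟨ +-congʳ (solve 4 (λ e x d a → e :* (x :* d :- a) := e :* x :* d :+ :- e :* a) refl E x (δ i j) (A i j)) ⟩
        P′ i j ∎

      -- Here r = B 1, so N r = (N B) 1 = E 1. Thus `r` is E times the solution of N y = 1 whose
      -- entries add up to the coronal, and C / E is the coronal.
      row-sum : ∀ v → sum (λ v′ → N v v′ * r v′) ≈ E
      row-sum v = begin
        sum (λ v′ → N v v′ * r v′)
          ≈⟨ sum-cong-≋ {n₂} (λ v′ → *-distribˡ-sum {n₂} (N v v′) (B v′)) ⟩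
        sum (λ v′ → sum (λ j → N v v′ * B v′ j))
          ≈⟨ ∑-comm {n₂} {n₂} (λ v′ j → N v v′ * B v′ j) ⟩
        sum (λ j → (N ⊡ B) v j)
          ≈⟨ sum-cong-≋ {n₂} (λ j → trans (NB≈E v j) (trans (*-comm _ _) (*-congˡ (sym (*-identityʳ E))))) ⟩
        sum (λ j → δ v j * (E * 1#))
          ≈⟨ sum-δ v (λ _ → E * 1#) ⟩
        E * 1#
          ≈⟨ *-identityʳ E ⟩
        E ∎

      -- This is the equation that dictates `S′`: S (E δ) = - E (A ⊗ 1) must cancel against T S′ = A
      -- ⊗ N r = E (A ⊗ 1), where 1 is the all-ones column.
      lowerLeft : ∀ w → (S ⊡ Eδ ⊞ T ⊡ S′) w ≋ 𝟎 {n₁ ℕ.* n₂} w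
      lowerLeft w j = begin
        (S ⊡ Eδ) w j + (T ⊡ S′) w j
          ≈⟨ +-cong (⊡-Eδ S w j) (sum-remQuot n₁ n₂ (λ p → (δ (k w) (proj₁ p) * N (u w) (proj₂ p)) * (A (proj₁ p) j * r (proj₂ p)))) ⟩
        E * - A (k w) j + sum (λ l → sum (λ v → (δ (k w) l * N (u w) v) * (A l j * r v)))
          ≈⟨ +-congˡ (sum-cong-≋ {n₁} (λ l → trans
               (sum-cong-≋ {n₂} (λ v → solve 4 (λ d n a r → (d :* n) :* (a :* r) := (d :* a) :* (n :* r)) refl (δ (k w) l) (N (u w) v) (A l j) (r v)))
               (trans (sym (*-distribˡ-sum {n₂} (δ (k w) l * A l j) (λ v → N (u w) v * r v)))
               (trans (*-congˡ (row-sum (u w))) (*-assoc _ _ _))))) ⟩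
        E * - A (k w) j + sum (λ l → δ (k w) l * (A l j * E))
          ≈⟨ +-congˡ (sum-δ (k w) (λ l → A l j * E)) ⟩
        E * - A (k w) j + A (k w) j * E
          ≈⟨ solve 2 (λ e a → e :* :- a :+ a :* e := :0) refl E (A (k w) j) ⟩
        0# ∎

      lowerRight : ∀ w → (S ⊡ 𝟎 ⊞ T ⊡ δ) w ≋ T w
      lowerRight w w′ = trans (+-cong (⊡-zeroʳ S w w′) (⊡-identityʳ T w w′)) (+-identityˡ _)

-- Clearing the denominators of a matrix of fractions without division.

module CommonDenominator {c ℓ} (R : CommutativeRing c ℓ) where
  open CommutativeRing R hiding (zero; Carrier)
  open RingSolver R
  open Determinant R
  open Multiplicativity R
  open Products R
  open import Algebra.Properties.CommutativeMonoid.Sum *-commutativeMonoid using () renaming (∑-comm to ∏-comm)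
  open import Relation.Binary.Reasoning.Setoid setoid

  private
    variable
      m n : ℕ

  -- The division-free form of ∏ q / q k.
  omit : Fin n → Vector (Carrier R) n → Carrier R
  omit {suc n} zero    q = ∏ (tail q)
  omit {suc n} (suc k) q = q zero * omit k (tail q)

  -- The vector t may differ from q at k; `omit-transpose` uses this with the value 1 there.
  ∏-omit : ∀ (k : Fin n) (q t : Vector (Carrier R) n) → (∀ j → ¬ k ≡ j → t j ≈ q j) → ∏ t ≈ t k * omit k q
  ∏-omit {suc n} zero    q t e = *-congˡ (∏-cong {n} (λ j → e (suc j) (λ ())))
  ∏-omit {suc n} (suc k) q t e = trans
    (*-cong (e zero (λ ())) (∏-omit k (tail q) (tail t) (λ j k≢j → e (suc j) (λ { ≡.refl → k≢j ≡.refl }))))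
    (solve 3 (λ a b c → a :* (b :* c) := b :* (a :* c)) refl _ _ _)

  -- The numerator of the sum of the fractions p k / q k, bracketed exactly as iterated `_+R_`
  -- produces it, so that `num-ΣR` is a propositional equality.
  numerator : Vector (Carrier R) n → Vector (Carrier R) n → Carrier R
  numerator {zero}  p q = 0#
  numerator {suc n} p q = p zero * ∏ (tail q) + numerator (tail p) (tail q) * q zero

  numerator≈sum : (p q : Vector (Carrier R) n) → numerator p q ≈ sum (λ k → p k * omit k q)
  numerator≈sum {zero}  p q = refl
  numerator≈sum {suc n} p q = +-congˡ (begin
    numerator (tail p) (tail q) * q zero
      ≈⟨ *-congʳ (numerator≈sum (tail p) (tail q)) ⟩
    sum (λ k → p (suc k) * omit k (tail q)) * q zero
      ≈⟨ *-distribʳ-sum {n} (q zero) (λ k → p (suc k) * omit k (tail q)) ⟩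
    sum (λ k → p (suc k) * omit k (tail q) * q zero)
      ≈⟨ sum-cong-≋ {n} (λ k → solve 3 (λ p o q → p :* o :* q := p :* (q :* o)) refl (p (suc k)) (omit k (tail q)) (q zero)) ⟩
    sum (λ k → p (suc k) * (q zero * omit k (tail q))) ∎)

  -- Both sides are the product of all entries of q except q k j, once by rows and once by columns.
  -- The matrix `t` has 1 in that place, and its full product may be taken in either order.
  omit-transpose : ∀ (k : Fin m) (j : Fin n) (q : Fin m → Vector (Carrier R) n) →
    omit j (q k) * omit k (λ i → ∏ (q i)) ≈ omit k (λ i → q i j) * omit j (λ j → ∏ (λ i → q i j))
  omit-transpose {m} {n} k j q = begin
    omit j (q k) * omit k (λ i → ∏ (q i))
      ≈⟨ *-congʳ (trans (∏-omit j (q k) (t k) (λ j′ j≢j′ → t-column k j≢j′)) (trans (*-congʳ t-hit) (*-identityˡ _))) ⟨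
    ∏ (t k) * omit k (λ i → ∏ (q i))
      ≈⟨ ∏-omit k (λ i → ∏ (q i)) (λ i → ∏ (t i)) (λ i k≢i → ∏-cong {n} (λ j′ → t-row k≢i j′)) ⟨
    ∏ (λ i → ∏ (t i))
      ≈⟨ ∏-comm {m} {n} t ⟩
    ∏ (λ j → ∏ (λ i → t i j))
      ≈⟨ ∏-omit j (λ j → ∏ (λ i → q i j)) (λ j → ∏ (λ i → t i j)) (λ j′ j≢j′ → ∏-cong {m} (λ i → t-column i j≢j′)) ⟩
    ∏ (λ i → t i j) * omit j (λ j → ∏ (λ i → q i j))
      ≈⟨ *-congʳ (trans (∏-omit k (λ i → q i j) (λ i → t i j) (λ i k≢i → t-row k≢i j)) (trans (*-congʳ t-hit) (*-identityˡ _))) ⟩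
    omit k (λ i → q i j) * omit j (λ j → ∏ (λ i → q i j)) ∎
    where
    t : Fin m → Vector (Carrier R) n
    t i j′ = if does (k Fin.≟ i) then (if does (j Fin.≟ j′) then 1# else q i j′) else q i j′

    t-hit : t k j ≈ 1#
    t-hit with k Fin.≟ k | j Fin.≟ j
    ... | yes _ | yes _  = refl
    ... | yes _ | no j≢j = ⊥-elim (j≢j ≡.refl)
    ... | no k≢k | _     = ⊥-elim (k≢k ≡.refl)

    t-row : ∀ {i} → ¬ k ≡ i → ∀ j′ → t i j′ ≈ q i j′
    t-row {i} k≢i j′ with k Fin.≟ i
    ... | yes k≡i = ⊥-elim (k≢i k≡i)
    ... | no _    = refl

    t-column : ∀ i {j′} → ¬ j ≡ j′ → t i j′ ≈ q i j′
    t-column i {j′} j≢j′ with k Fin.≟ i | j Fin.≟ j′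
    ... | _     | yes j≡j′ = ⊥-elim (j≢j′ j≡j′)
    ... | yes _ | no _     = refl
    ... | no _  | no _     = refl

  module _ (p q : Fin n → Vector (Carrier R) n) where
    denominator : Carrier R
    denominator = ∏ (λ i → ∏ (q i))

    -- The fraction p k j / q k j multiplied by `denominator`. The other denominators are grouped by
    -- rows, as the sums in `coronal` group them; the product with N needs the grouping by columns.
    cleared : Fin n → Vector (Carrier R) n
    cleared k j = p k j * (omit j (q k) * omit k (λ i → ∏ (q i)))

    -- The hypothesis is column j of the inverse equation with the denominators of that column
    -- cleared; the denominators of the other columns, `omit j D`, complete the product.
    cleared-inverse : (N : Fin n → Vector (Carrier R) n) →
      (∀ i j → sum (λ k → (N i k * p k j) * omit k (λ k → q k j)) ≈ δ i j * ∏ (λ k → q k j)) →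
      ∀ i j → (N ⊡ cleared) i j ≈ denominator * δ i j
    cleared-inverse N inverse i j = begin
      sum (λ k → N i k * (p k j * (omit j (q k) * omit k (λ i → ∏ (q i)))))
        ≈⟨ sum-cong-≋ {n} (λ k → trans (*-congˡ (*-congˡ (omit-transpose k j q)))
             (solve 4 (λ a p o z → a :* (p :* (o :* z)) := a :* p :* o :* z) refl (N i k) (p k j) _ _)) ⟩
      sum (λ k → (N i k * p k j) * omit k (λ k → q k j) * omit j D)
        ≈⟨ *-distribʳ-sum {n} (omit j D) (λ k → (N i k * p k j) * omit k (λ k → q k j)) ⟨
      sum (λ k → (N i k * p k j) * omit k (λ k → q k j)) * omit j D
        ≈⟨ *-congʳ (inverse i j) ⟩
      δ i j * D j * omit j D
        ≈⟨ solve 3 (λ d x y → d :* x :* y := x :* y :* d) refl (δ i j) (D j) (omit j D) ⟩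
      D j * omit j D * δ i j
        ≈⟨ *-congʳ (trans (∏-comm {n} {n} q) (∏-omit j D D (λ _ _ → refl))) ⟨
      denominator * δ i j ∎
      where
      D : Vector (Carrier R) n
      D j = ∏ (λ k → q k j)

    sum-cleared : sum (λ i → sum (λ j → p i j * omit j (q i)) * omit i (λ i → ∏ (q i))) ≈ sum (λ i → sum (cleared i))
    sum-cleared = sum-cong-≋ {n} (λ i → trans
      (*-distribʳ-sum {n} (omit i (λ i → ∏ (q i))) (λ j → p i j * omit j (q i)))
      (sum-cong-≋ {n} (λ j → *-assoc (p i j) (omit j (q i)) (omit i (λ i → ∏ (q i))))))

-- Passage between the stated rational functions and the polynomial ring.

module RationalFunctions {c ℓ} (F : CommutativeRing c ℓ) where
  private
    module F = CommutativeRing F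
  open Over F
  open PolynomialRing F
  open CommutativeRing polynomialRing hiding (zero)
  open RingSolver polynomialRing
  open Determinant polynomialRing
  open Multiplicativity polynomialRing
  open BlockMatrices polynomialRing using (_^_; ^-cong)
  open Products polynomialRing
  open CommonDenominator polynomialRing
  open CoronaDeterminant polynomialRing X
  open import Relation.Binary.Reasoning.Setoid setoid

  altSumP≃altSum : ∀ {n} (t : Fin n → Poly) → altSumP t ≃ altSum t
  altSumP≃altSum {zero}  t = sym (altSum-zero (λ ()))
  altSumP≃altSum {suc n} t = trans (+-congˡ {t zero} (-‿cong (altSumP≃altSum (tail t)))) (sym (altSum-suc t))

  detP≃det : ∀ {n} (M : Fin n → Fin n → Poly) → detP M ≃ det M
  detP≃det {zero}  M = sym (det-zero M)
  detP≃det {suc n} M = trans (altSumP≃altSum (λ j → M zero j *P detP (λ r s → M (suc r) (punchIn j s))))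
    (trans (altSum-cong (λ j → *-congˡ {M zero j} (detP≃det (λ r s → M (suc r) (punchIn j s))))) (sym (det-suc M)))

  ∏P≃∏ : ∀ {n} (t : Fin n → Poly) → ∏P t ≃ ∏ t
  ∏P≃∏ {zero}  t = refl
  ∏P≃∏ {suc n} t = *-congˡ {t zero} (∏P≃∏ (tail t))

  -- Fractions are never reduced, so numerators and denominators of sums and products are known up
  -- to `≡`.
  den-ΣR : ∀ {n} (f : Fin n → RatFun) → den (ΣR f) ≡ ∏ (λ i → den (f i))
  den-ΣR {zero}  f = ≡.refl
  den-ΣR {suc n} f = ≡.cong (den (f zero) *P_) (den-ΣR (tail f))

  num-ΣR : ∀ {n} (f : Fin n → RatFun) → num (ΣR f) ≡ numerator (λ i → num (f i)) (λ i → den (f i))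
  num-ΣR {zero}  f = ≡.refl
  num-ΣR {suc n} f = ≡.cong₂ _+P_ (≡.cong (num (f zero) *P_) (den-ΣR (tail f))) (≡.cong (_*P den (f zero)) (num-ΣR (tail f)))

  num-∏R : ∀ {n} (f : Fin n → RatFun) → num (∏R f) ≡ ∏ (λ i → num (f i))
  num-∏R {zero}  f = ≡.refl
  num-∏R {suc n} f = ≡.cong (num (f zero) *P_) (num-∏R (tail f))

  den-∏R : ∀ {n} (f : Fin n → RatFun) → den (∏R f) ≡ ∏ (λ i → den (f i))
  den-∏R {zero}  f = ≡.refl
  den-∏R {suc n} f = ≡.cong (den (f zero) *P_) (den-∏R (tail f))

  num-^R : ∀ p n → num (poly p ^R n) ≡ p ^ n
  num-^R p zero    = ≡.refl
  num-^R p (suc n) = ≡.cong (p *P_) (num-^R p n)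

  den-^R : ∀ p n → den (poly p ^R n) ≃ 1P
  den-^R p zero    = refl
  den-^R p (suc n) = trans (*-identityˡ (den (poly p ^R n))) (den-^R p n)

  ∏-const : ∀ n {t : Fin n → Poly} {e} → (∀ i → t i ≃ e) → ∏ t ≃ e ^ n
  ∏-const zero    t≃e = refl
  ∏-const (suc n) t≃e = *-cong (t≃e zero) (∏-const n (λ i → t≃e (suc i)))

  omit-cong : ∀ {n} (k : Fin n) {q q′ : Fin n → Poly} → (∀ i → q i ≃ q′ i) → omit k q ≃ omit k q′
  omit-cong {suc n} zero    e = ∏-cong {n} (λ i → e (suc i))
  omit-cong {suc n} (suc k) e = *-cong (e zero) (omit-cong k (λ i → e (suc i)))

  -- The entry 0 of an adjacency matrix becomes the list `0# ∷ []`, whereas zero of the polynomial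
  -- ring is `[]`; the two agree only as polynomials.
  constP-indicator : ∀ b → constP (if b then F.1# else F.0#) ≃ indicator b
  constP-indicator true  = refl
  constP-indicator false = Hom.0#-homo constantHom

  X*δ : ∀ {n} (i j : Fin n) → (if does (i Fin.≟ j) then X else 0P) ≃ X *P δ i j
  X*δ i j with does (i Fin.≟ j)
  ... | true  = sym (*-identityʳ X)
  ... | false = sym (zeroʳ X)

  xI-P≃characteristic : ∀ {n} (G : Graph n) i j → xI-P (A G) i j ≃ characteristic G i j
  xI-P≃characteristic G i j = +-cong (X*δ i j) (-‿cong (constP-indicator (adj G i j)))

  φ≃det : ∀ {n} (G : Graph n) → φ (A G) ≃ det (characteristic G)
  φ≃det G = trans (detP≃det (xI-P (A G))) (det-cong (xI-P≃characteristic G))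

  splits : ∀ {n} (M : Matrix n) (λs : Fin n → F.Carrier) → φ M ≈P ∏P (λ i → X -P constP (λs i)) →
    Spectrum.Splits F M λs polynomialExtension
  splits M λs e = begin
    det (λ i j → X *P δ i j -P constP (M i j))
      ≈⟨ det-cong (λ i j → +-congʳ (X*δ i j)) ⟨
    det (xI-P M)
      ≈⟨ detP≃det (xI-P M) ⟨
    φ M
      ≈⟨ ≈P⇒≃ e ⟩
    ∏P (λ i → X -P constP (λs i))
      ≈⟨ ∏P≃∏ (λ i → X -P constP (λs i)) ⟩
    ∏ (λ i → X -P constP (λs i)) ∎

  module _ {n} (B : Fin n → Fin n → RatFun) where
    p q : Fin n → Fin n → Poly
    p i j = num (B i j)
    q i j = den (B i j)

    den-coronal : den (coronal B) ≃ denominator p q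
    den-coronal = trans (reflexive (den-ΣR (λ i → ΣR (B i)))) (∏-cong {n} (λ i → reflexive (den-ΣR (B i))))

    num-coronal : num (coronal B) ≃ sum (λ i → sum (cleared p q i))
    num-coronal = begin
      num (coronal B)
        ≈⟨ reflexive (num-ΣR (λ i → ΣR (B i))) ⟩
      numerator (λ i → num (ΣR (B i))) (λ i → den (ΣR (B i)))
        ≈⟨ numerator≈sum (λ i → num (ΣR (B i))) (λ i → den (ΣR (B i))) ⟩
      sum (λ i → num (ΣR (B i)) *P omit i (λ i → den (ΣR (B i))))
        ≈⟨ sum-cong-≋ {n} (λ i → *-cong
             (trans (reflexive (num-ΣR (B i))) (numerator≈sum (p i) (q i)))
             (omit-cong i (λ i → reflexive (den-ΣR (B i))))) ⟩
      sum (λ i → sum (λ j → p i j *P omit j (q i)) *P omit i (λ i → ∏ (q i)))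
        ≈⟨ sum-cleared p q ⟩
      sum (λ i → sum (cleared p q i)) ∎

    inverse : (G : Graph n) → IsInverseOf-xI- (A G) B →
      ∀ i j → (characteristic G ⊡ cleared p q) i j ≃ denominator p q *P δ i j
    inverse G (_ , e) = cleared-inverse p q (characteristic G) column
      where
      f : Fin n → Fin n → Fin n → RatFun
      f i j k = poly (xI-P (A G) i k) *R B k j

      -- The numerators of `1R` and `0R` are the entries of `δ`, and their denominators are 1.
      identity : ∀ i j → num (ΣR (f i j)) ≃ δ i j *P den (ΣR (f i j))
      identity i j with does (i Fin.≟ j) | ≈P⇒≃ (e i j)
      ... | true  | e = trans (sym (*-identityʳ (num (ΣR (f i j))))) e
      ... | false | e = trans (sym (*-identityʳ (num (ΣR (f i j))))) e

      column : ∀ i j → sum (λ k → (characteristic G i k *P p k j) *P omit k (λ k → q k j)) ≃ δ i j *P ∏ (λ k → q k j)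
      column i j = begin
        sum (λ k → (characteristic G i k *P p k j) *P omit k (λ k → q k j))
          ≈⟨ sum-cong-≋ {n} (λ k → *-cong (*-congʳ {p k j} (xI-P≃characteristic G i k)) (omit-cong k (λ k → *-identityˡ (q k j)))) ⟨
        sum (λ k → num (f i j k) *P omit k (λ k → den (f i j k)))
          ≈⟨ numerator≈sum (λ k → num (f i j k)) (λ k → den (f i j k)) ⟨
        numerator (λ k → num (f i j k)) (λ k → den (f i j k))
          ≈⟨ reflexive (num-ΣR (f i j)) ⟨
        num (ΣR (f i j))
          ≈⟨ identity i j ⟩
        δ i j *P den (ΣR (f i j))
          ≈⟨ *-congˡ {δ i j} (trans (reflexive (den-ΣR (f i j))) (∏-cong {n} (λ k → *-identityˡ (q k j)))) ⟩
        δ i j *P ∏ (λ k → q k j) ∎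

  module _ {n₁ n₂} (G₁ : Graph n₁) (G₂ : Graph n₂) (λs : Fin n₁ → F.Carrier)
    (split : φ (A G₁) ≈P ∏P (λ i → X -P constP (λs i)))
    (B : Fin n₂ → Fin n₂ → RatFun) (inv : IsInverseOf-xI- (A G₂) B) where

    private
      E C : Poly
      E = denominator (p B) (q B)
      C = sum (λ i → sum (cleared (p B) (q B) i))

      μ : Fin n₁ → Poly
      μ i = constP (λs i)

      factor : Fin n₁ → RatFun
      factor i = (poly X -R poly (μ i)) -R (coronal B *R poly (constP (λs i F.* λs i)))

      a : Fin n₁ → Fin n₁ → Poly
      a i j = constP (A G₁ i j)

      -- Over the denominator E each factor has as numerator the value at μ of w + v y + u y², with
      -- w = E x, v = - E and u = - C, as `det-quadratic` requires.
      num-factor : ∀ i → num (factor i) ≃ E *P X +P (-P E) *P μ i +P (-P C) *P (μ i *P μ i)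
      num-factor i = begin
        (X *P 1P +P (-P μ i) *P 1P) *P (den (coronal B) *P 1P) +P (-P (num (coronal B) *P constP (λs i F.* λs i))) *P (1P *P 1P)
          ≈⟨ +-cong (*-congˡ {X *P 1P +P (-P μ i) *P 1P} (*-congʳ {1P} (den-coronal B)))
                    (*-congʳ {1P *P 1P} (-‿cong (*-cong (num-coronal B) (Hom.*-homo constantHom (λs i) (λs i))))) ⟩
        (X *P 1P +P (-P μ i) *P 1P) *P (E *P 1P) +P (-P (C *P (μ i *P μ i))) *P (1P *P 1P)
          ≈⟨ solve 4 (λ x m e c → (x :* :1 :+ (:- m) :* :1) :* (e :* :1) :+ (:- (c :* (m :* m))) :* (:1 :* :1) :=
               e :* x :+ (:- e) :* m :+ (:- c) :* (m :* m)) refl X (μ i) E C ⟩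
        E *P X +P (-P E) *P μ i +P (-P C) *P (μ i *P μ i) ∎

      den-factor : ∀ i → den (factor i) ≃ E
      den-factor i = trans (*-congˡ {1P *P 1P} (*-congʳ {1P} (den-coronal B)))
        (solve 1 (λ e → (:1 :* :1) :* (e :* :1) := e) refl E)

      base : det (λ i j → E *P X *P δ i j +P (-P E) *P adjacency G₁ i j +P (-P C) *P (adjacency G₁ ⊡ adjacency G₁) i j) ≃
        ∏ (λ i → num (factor i))
      base = begin
        det (λ i j → E *P X *P δ i j +P (-P E) *P adjacency G₁ i j +P (-P C) *P (adjacency G₁ ⊡ adjacency G₁) i j)
          ≈⟨ det-cong (λ i j → +-cong (+-congˡ {E *P X *P δ i j} (*-congˡ { -P E} (constP-indicator (adj G₁ i j))))
               (*-congˡ { -P C} (sum-cong-≋ {n₁} (λ k → *-cong (constP-indicator (adj G₁ i k)) (constP-indicator (adj G₁ k j)))))) ⟨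
        det (λ i j → E *P X *P δ i j +P (-P E) *P a i j +P (-P C) *P (a ⊡ a) i j)
          ≈⟨ Spectrum.det-quadratic F (A G₁) λs polynomialExtension (splits (A G₁) λs split) constantHom (-P C) (-P E) (E *P X) ⟩
        ∏ (λ i → E *P X +P (-P E) *P μ i +P (-P C) *P (μ i *P μ i))
          ≈⟨ ∏-cong {n₁} num-factor ⟨
        ∏ (λ i → num (factor i)) ∎

    -- Cross-multiplying puts the denominators of the n₁ factors, together `E ^ n₁`, next to the
    -- characteristic polynomial of the corona. That is the left side of `det-⋆`, so nothing has to
    -- be cancelled.
    φ-⋆ : poly (φ (A (G₁ ⋆ G₂))) ≈R (poly (φ (A G₂)) ^R n₁) *R ∏R factor
    φ-⋆ = ≃⇒≈P (begin
      φ (A (G₁ ⋆ G₂)) *P (den (poly (φ (A G₂)) ^R n₁) *P den (∏R factor))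
        ≈⟨ *-cong (φ≃det (G₁ ⋆ G₂)) (trans (*-cong (den-^R (φ (A G₂)) n₁) (trans (reflexive (den-∏R factor)) (∏-const n₁ den-factor)))
             (*-identityˡ (E ^ n₁))) ⟩
      det (characteristic (G₁ ⋆ G₂)) *P E ^ n₁
        ≈⟨ det-⋆ G₁ G₂ (cleared (p B) (q B)) E (inverse B G₂ inv) ⟩
      det (λ i j → E *P X *P δ i j +P (-P E) *P adjacency G₁ i j +P (-P C) *P (adjacency G₁ ⊡ adjacency G₁) i j) *P det (characteristic G₂) ^ n₁
        ≈⟨ *-cong base (^-cong (sym (φ≃det G₂)) (≡.refl {x = n₁})) ⟩
      ∏ (λ i → num (factor i)) *P φ (A G₂) ^ n₁
        ≈⟨ *-comm (∏ (λ i → num (factor i))) (φ (A G₂) ^ n₁) ⟩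
      φ (A G₂) ^ n₁ *P ∏ (λ i → num (factor i))
        ≈⟨ *-cong (reflexive (num-^R (φ (A G₂)) n₁)) (reflexive (num-∏R factor)) ⟨
      num (poly (φ (A G₂)) ^R n₁) *P num (∏R factor)
        ≈⟨ *-identityʳ (num (poly (φ (A G₂)) ^R n₁) *P num (∏R factor)) ⟨
      num (poly (φ (A G₂)) ^R n₁) *P num (∏R factor) *P 1P ∎)

theorem2p1 : {c ℓ : Level} (F : CommutativeRing c ℓ) → Over.IsField F →
  (n₁ n₂ : ℕ) → 1 ≤ n₁ → 1 ≤ n₂ →
  (G₁ : Graph n₁) (G₂ : Graph n₂) →
  -- λ i are the eigenvalues of A(G₁) (with multiplicity): φ(A(G₁); x) = ∏ (x - λ i)
  (λs : Fin n₁ → CommutativeRing.Carrier F) →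
  Over._≈P_ F (Over.φ F (Over.A F G₁))
    (Over.∏P F (λ i → Over._-P_ F (Over.X F) (Over.constP F (λs i)))) →
  -- B = (x I - A(G₂))⁻¹ over the field of rational functions
  (B : Fin n₂ → Fin n₂ → Over.RatFun F) →
  Over.IsInverseOf-xI- F (Over.A F G₂) B →
  Over._≈R_ F
    (Over.poly F (Over.φ F (Over.A F (G₁ ⋆ G₂))))
    (Over._*R_ F
      (Over._^R_ F (Over.poly F (Over.φ F (Over.A F G₂))) n₁)
      (Over.∏R F (λ i →
        Over._-R_ F
          (Over._-R_ F (Over.poly F (Over.X F)) (Over.poly F (Over.constP F (λs i))))
          (Over._*R_ F (Over.coronal F B)
            (Over.poly F (Over.constP F (CommutativeRing._*_ F (λs i) (λs i))))))))
theorem2p1 F _ n₁ n₂ _ _ G₁ G₂ λs split B inverse = RationalFunctions.φ-⋆ F G₁ G₂ λs split B inverse
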